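{- For every integer $k\ge1$, $$E^{(k-1)(k-2)\cdots1k}_{3\text{ - }12}(x)=\begin{cases}\dfrac{e^{e^x}}{(k-1)!}\displaystyle\int_0^x t^{k-1}e^{ -e^t+t}\,dt,&\text{if }k\ge2,\\[2mm] e^{e^x-1},&\text{if }k=1.\end{cases}$$
   Context: A permutation $\pi=\pi_1\cdots\pi_n$ of $\{1,\dots,n\}$ contains the generalized pattern $3\text{ - }12$ if there are indices $i<j<n$ such that $\pi_i\pi_j\pi_{j+1}$ is order-isomorphic to $312$; otherwise it avoids it. A permutation $\pi$ begins with a pattern $p=p_1\cdots p_k$ if $n\ge k$ and $\pi_1\cdots\pi_k$ is order-isomorphic to $p$; by convention, the empty permutation is also regarded as beginning with the pattern $1$ (the case $k=1$). The pattern $(k-1)(k-2)\cdots1k$ consists of $k-1,k-2,\dots,1$ in decreasing order followed by $k$ (for $k=1$ it is $1$, for $k=2$ it is $12$). $E^p_q(x)=\sum_{n\ge0}N^p_q(n)\frac{x^n}{n!}$, where $N^p_q(n)$ is the number of permutations of $\{1,\dots,n\}$ that avoid $q$ and begin with $p$. Identities are identities of power series in $x$. -}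

module Defs where

open import Algebra.Bundles using (CommutativeRing)
open import Algebra.Morphism.Structures using (module MonoidMorphisms; module RingMorphisms)
import Algebra.Definitions.RawMonoid as RawMonoidDefinitions
open import Data.Fin.Base as Fin using (Fin; toℕ)
import Data.Fin.Properties as Fin
open import Data.Integer.Base using (+_)
open import Data.List.Base using (List; allFin; cartesianProductWith; filter; length; [_])
open import Data.Nat.Base using (ℕ; zero; suc; _∸_; _<_; _≤_; _!)
open import Data.Nat.Properties using (_≟_; _<?_; _≤?_; _!≢0)
open import Data.Product.Base using (_×_; _,_; ∃-syntax; Σ-syntax)
open import Data.Rational.Base using (ℚ; _/_; +-*-rawRing)
open import Data.Sum.Base using (_⊎_)
open import Data.Vec.Base using (Vec; []; _∷_; _∷ʳ_; lookup; tabulate)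
open import Data.Vec.Relation.Unary.AllPairs using (allPairs?)
open import Level using (_⊔_) renaming (suc to lsuc)
open import Relation.Binary.PropositionalEquality using (_≡_)
open import Relation.Nullary using (Dec; yes; no; ¬_)
open import Relation.Nullary.Decidable using (map′; ¬?; _×-dec_; _⊎-dec_; _→-dec_)
open import Relation.Unary using (Decidable)

------------------------------------------------------------------------
-- Permutations and patterns

-- A permutation of {1,…,n} is a word π : Vec (Fin n) n without repeated
-- letters, the element i : Fin n standing for the letter 1 + toℕ i.

words : ∀ m n → List (Vec (Fin m) n)
words m zero    = [ [] ]
words m (suc n) = cartesianProductWith _∷_ (allFin m) (words m n)

permutations : ∀ n → List (Vec (Fin n) n)
permutations n = filter (allPairs? λ i j → ¬? (i Fin.≟ j)) (words n n)

OrderIsomorphic : ∀ {n k} → Vec (Fin n) k → Vec ℕ k → Set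
OrderIsomorphic u p =
  ∀ i j → (lookup u i Fin.< lookup u j → lookup p i < lookup p j)
        × (lookup p i < lookup p j → lookup u i Fin.< lookup u j)

orderIsomorphic? : ∀ {n k} (u : Vec (Fin n) k) (p : Vec ℕ k) →
                   Dec (OrderIsomorphic u p)
orderIsomorphic? u p = Fin.all? λ i → Fin.all? λ j →
  let u< = lookup u i Fin.<? lookup u j
      p< = lookup p i <? lookup p j
  in (u< →-dec p<) ×-dec (p< →-dec u<)

-- In the pattern 3-12 the last two letters have to be adjacent.

Contains3-12 : ∀ {n} → Vec (Fin n) n → Set
Contains3-12 {n} π =
  ∃[ i ] ∃[ j ] ∃[ j′ ]
    i Fin.< j × toℕ j′ ≡ suc (toℕ j)
    × OrderIsomorphic (lookup π i ∷ lookup π j ∷ lookup π j′ ∷ []) (3 ∷ 1 ∷ 2 ∷ [])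

Avoids3-12 : ∀ {n} → Vec (Fin n) n → Set
Avoids3-12 π = ¬ Contains3-12 π

avoids3-12? : ∀ {n} → Decidable (Avoids3-12 {n})
avoids3-12? π = ¬? (Fin.any? λ i → Fin.any? λ j → Fin.any? λ j′ →
  (i Fin.<? j) ×-dec (toℕ j′ ≟ suc (toℕ j)) 
  ×-dec orderIsomorphic? (lookup π i ∷ lookup π j ∷ lookup π j′ ∷ []) (3 ∷ 1 ∷ 2 ∷ []))

prefix : ∀ {A : Set} {k n} → .(k ≤ n) → Vec A n → Vec A k
prefix k≤n xs = tabulate λ i → lookup xs (Fin.inject≤ i k≤n)

-- The first alternative is the convention that the empty permutation
-- begins with the pattern 1.

BeginsWith : ∀ {k n} → Vec ℕ k → Vec (Fin n) n → Set
BeginsWith {k} {n} p π =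
  (n ≡ 0 × k ≡ 1) ⊎ (Σ[ k≤n ∈ k ≤ n ] OrderIsomorphic (prefix k≤n π) p)

beginsWith? : ∀ {k} (p : Vec ℕ k) {n} → Decidable (BeginsWith {n = n} p)
beginsWith? {k} p {n} π = ((n ≟ 0) ×-dec (k ≟ 1)) ⊎-dec prefix?
  where
  prefix? : Dec (Σ[ k≤n ∈ k ≤ n ] OrderIsomorphic (prefix k≤n π) p)
  prefix? with k ≤? n
  ... | no  k≰n = no λ (k≤n , _) → k≰n k≤n
  ... | yes k≤n = map′ (k≤n ,_) (λ (_ , iso) → iso) (orderIsomorphic? (prefix k≤n π) p)

-- The number of permutations of {1,…,n} that avoid 3-12 and begin with p.

N : ∀ {k} → Vec ℕ k → ℕ → ℕ
N p n = length (filter (λ π → avoids3-12? π ×-dec beginsWith? p π) (permutations n))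

-- m (m-1) … 1

decreasing : ∀ m → Vec ℕ m
decreasing zero    = []
decreasing (suc m) = suc m ∷ decreasing m

-- (k-1) (k-2) … 1 k; only k ≥ 1 is meaningful.

decreasingThenMax : ∀ k → Vec ℕ k
decreasingThenMax zero    = []
decreasingThenMax (suc m) = decreasing m ∷ʳ suc m

------------------------------------------------------------------------
-- Coefficients

-- Series such as e^(e^x) have the non-rational constant term e, so
-- coefficients are taken in an arbitrary commutative ℚ-algebra with an
-- exponential map satisfying e^(a+b) = e^a e^b and e^0 = 1.  Examples
-- are ℝ with the usual exponential, and ℚ with the map constantly 1.

record ExponentialℚAlgebra c ℓ : Set (lsuc (c ⊔ ℓ)) where
  field
    commutativeRing : CommutativeRing c ℓ

  open CommutativeRing commutativeRing public

  field
    fromℚ   : ℚ → Carrier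
    fromℚ-isRingHomomorphism :
      RingMorphisms.IsRingHomomorphism +-*-rawRing rawRing fromℚ
    e^_     : Carrier → Carrier
    e^-isMonoidHomomorphism :
      MonoidMorphisms.IsMonoidHomomorphism +-rawMonoid *-rawMonoid e^_

------------------------------------------------------------------------
-- Formal power series in one variable

module PowerSeries {c ℓ} (R : ExponentialℚAlgebra c ℓ) where

  open ExponentialℚAlgebra R
  open RawMonoidDefinitions +-rawMonoid using (sum)

  -- F n is the coefficient of xⁿ.

  Series : Set c
  Series = ℕ → Carrier

  infix  4 _≋_
  infixl 6 _⊕_ _⊖_
  infixl 7 _⊛_
  infixr 7 _•_
  infix  8 ⊝_
  infixr 9 _^^_

  _≋_ : Series → Series → Set ℓ
  F ≋ G = ∀ n → F n ≈ G n

  _⊕_ : Series → Series → Series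
  (F ⊕ G) n = F n + G n

  ⊝_ : Series → Series
  (⊝ F) n = - F n

  _⊖_ : Series → Series → Series
  F ⊖ G = F ⊕ ⊝ G

  _•_ : ℚ → Series → Series
  (q • F) n = fromℚ q * F n

  const : Carrier → Series
  const a zero    = a
  const a (suc _) = 0#

  𝟙 : Series
  𝟙 = const 1#

  X : Series
  X 1 = 1#
  X _ = 0#

  _⊛_ : Series → Series → Series
  (F ⊛ G) n = sum {suc n} λ i → F (toℕ i) * G (n ∸ toℕ i)

  _^^_ : Series → ℕ → Series
  F ^^ zero  = 𝟙
  F ^^ suc m = F ⊛ F ^^ m

  1/_! : ℕ → ℚ
  1/ n ! = + 1 / (n !)
    where instance _ = n !≢0

  -- e^F = e^a · Σₘ Gᵐ / m!  with a the constant term of F and G = F - a.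
  -- Since Gᵐ only has terms of degree at least m, the coefficient of xⁿ
  -- involves only m ≤ n.

  exp : Series → Series
  exp F n = e^ F 0 * sum {suc n} λ m → (1/ toℕ m ! • (F ⊖ const (F 0)) ^^ toℕ m) n

  ∫₀ˣ : Series → Series
  ∫₀ˣ F zero    = 0#
  ∫₀ˣ F (suc n) = fromℚ (+ 1 / suc n) * F n

  -- E^p_{3-12}(x)

  E : ∀ {k} → Vec ℕ k → Series
  E p n = fromℚ (+ N p n / (n !))
    where instance _ = n !≢0

{-# OPTIONS --safe #-}

-- A word avoids 3-12 exactly when every ascent top exceeds all earlier letters, that is,
-- when each descending run starts with the maximum so far. Removing the run that contains
-- the largest letter, of length i + 1, shows that the number f(n) of such permutations
-- satisfies f(n+1) = Σᵢ C(n,i) f(n-i). If the first run has to have length k-1 and must not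
-- be the whole word, then C(n,k-1) is added, for the case that the removed run is the
-- second one. So the exponential generating function solves F′ = eˣ F, respectively
-- F′ = eˣ F + x^(k-1) eˣ / (k-1)!, and a solution is determined by its constant term.

module Submission where

open import Defs
open import Algebra.Morphism.Structures using (module RingMorphisms; module MonoidMorphisms)
open import Data.Bool.Base using (Bool; true; false; T; not; _∧_; _∨_)
open import Data.Bool.Properties using (∨-identityʳ; T?; T-∧; T-∨)
open import Data.Empty using (⊥)
open import Data.Fin.Base as Fin using (Fin; toℕ; punchIn) renaming (zero to fzero; suc to fsuc)
import Data.Fin.Properties as Fin
import Data.Integer.Base as ℤ
import Data.Integer.Properties as ℤ
open import Data.Integer.Base using (+_)
open import Data.List.Base as List using (List; []; _∷_; _++_; cartesianProductWith; filter; length)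
import Data.List.Properties as List
open import Data.Nat.Base hiding (_/_)
import Data.Nat.ListAction as ListAction
import Data.Nat.ListAction.Properties as ListAction
import Data.Nat.Properties as ℕ
open import Data.Nat.Properties using (_!≢0)
open import Data.Nat.Solver using (module +-*-Solver)
open import Data.Nat.Tactic.RingSolver using (solve-∀)
open import Data.Product.Base using (_×_; _,_; proj₁; proj₂; Σ-syntax)
open import Data.Rational.Base using (_/_; fromℚᵘ)
import Data.Rational.Base as ℚ
import Data.Rational.Properties as ℚ
import Data.Rational.Unnormalised.Base as ℚᵘ
import Data.Rational.Unnormalised.Properties as ℚᵘ
open import Data.Sum.Base using (_⊎_; inj₁; inj₂)
open import Data.Unit.Base using (⊤; tt)
open import Data.Vec.Base as Vec using (Vec; []; _∷_; _∷ʳ_; lookup)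
open import Data.Vec.Relation.Unary.All as All using (All; []; _∷_)
open import Data.Vec.Relation.Unary.AllPairs using (AllPairs; []; _∷_; allPairs?)
open import Function.Base using (_∘_; id)
open import Function.Bundles using (_⇔_; mk⇔; module Equivalence)
open import Level using (Level)
open import Relation.Binary.Definitions using (tri<; tri≈; tri>)
open import Relation.Binary.PropositionalEquality as ≡
  using (_≡_; _≢_; _≗_; refl; cong; cong₂; sym; trans; subst; module ≡-Reasoning)
import Relation.Binary.Reasoning.Setoid as SetoidReasoning
open import Relation.Nullary using (yes; no; does; ¬_; contradiction)
open import Relation.Nullary.Decidable using (¬?; does-⇔; _×-dec_)
open import Relation.Unary using (Decidable)

open Equivalence using (to; from)

-- Sequences and the binomial transform

-- The run of the largest letter is the last one, as a further run would have to start with a still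
-- larger letter. Any set of letters that contains the largest can form it, after an arbitrary
-- avoiding arrangement of the others; hence the binomial transform. The obstacle is that words are
-- taken apart from the front, as a first letter and a standardised rest, whereas the removed run
-- sits at the end. This gives `completions` and `firstRun`. The removal of the last run reappears
-- as the identities `completions-suc` and `firstRun-suc`, which are proved for all states because
-- the induction changes both numbers, and are then specialised to s = 0, the state before the first
-- letter.

infixl 6 _⊞_
_⊞_ : (ℕ → ℕ) → (ℕ → ℕ) → ℕ → ℕ
(f ⊞ g) n = f n + g n

-- The binomial transform Σᵢ C(n,i) f(n-i), written with Pascal's rule.

binomial : (ℕ → ℕ) → ℕ → ℕ
binomial f zero    = f zero
binomial f (suc n) = binomial f n + binomial (f ∘ suc) n

-- C(n,r) f(n-r), again written with Pascal's rule.

choose : ℕ → (ℕ → ℕ) → ℕ → ℕ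
choose zero    f n       = f n
choose (suc r) f zero    = 0
choose (suc r) f (suc n) = choose (suc r) (f ∘ suc) n + choose r f n

binomials : ℕ → ℕ → ℕ
binomials r = choose r λ _ → 1

-- Formal power series

fromℚᵘ-* : ∀ p q → fromℚᵘ p ℚ.* fromℚᵘ q ≡ fromℚᵘ (p ℚᵘ.* q)
fromℚᵘ-* p q = ℚ.toℚᵘ-injective (ℚᵘ.≃-trans (ℚ.toℚᵘ-homo-* (fromℚᵘ p) (fromℚᵘ q))
  (ℚᵘ.≃-trans (ℚᵘ.*-cong (ℚ.toℚᵘ-fromℚᵘ p) (ℚ.toℚᵘ-fromℚᵘ q)) (ℚᵘ.≃-sym (ℚ.toℚᵘ-fromℚᵘ _))))

fromℚᵘ-+ : ∀ p q → fromℚᵘ p ℚ.+ fromℚᵘ q ≡ fromℚᵘ (p ℚᵘ.+ q)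
fromℚᵘ-+ p q = ℚ.toℚᵘ-injective (ℚᵘ.≃-trans (ℚ.toℚᵘ-homo-+ (fromℚᵘ p) (fromℚᵘ q))
  (ℚᵘ.≃-trans (ℚᵘ.+-cong (ℚ.toℚᵘ-fromℚᵘ p) (ℚ.toℚᵘ-fromℚᵘ q)) (ℚᵘ.≃-sym (ℚ.toℚᵘ-fromℚᵘ _))))

/-+ : ∀ a b d .{{_ : NonZero d}} → + (a + b) / d ≡ + a / d ℚ.+ + b / d
/-+ a b d@(suc d-1) = sym (trans (fromℚᵘ-+ (ℚᵘ.mkℚᵘ (+ a) d-1) (ℚᵘ.mkℚᵘ (+ b) d-1))
  (ℚ.fromℚᵘ-cong {ℚᵘ.mkℚᵘ (+ a) d-1 ℚᵘ.+ ℚᵘ.mkℚᵘ (+ b) d-1} {ℚᵘ.mkℚᵘ (+ (a + b)) d-1} (ℚᵘ.*≡* eq)))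
  where
  lemma : ∀ a b d → (a * d + b * d) * d ≡ (a + b) * (d * d)
  lemma = solve-∀
  eq : (+ a ℤ.* + d ℤ.+ + b ℤ.* + d) ℤ.* + d ≡ + (a + b) ℤ.* + (d * d)
  eq = begin
    (+ a ℤ.* + d ℤ.+ + b ℤ.* + d) ℤ.* + d ≡⟨ cong (ℤ._* + d) (cong₂ ℤ._+_ (sym (ℤ.pos-* a d)) (sym (ℤ.pos-* b d))) ⟩
    + (a * d + b * d) ℤ.* + d             ≡⟨ ℤ.pos-* (a * d + b * d) d ⟨
    + ((a * d + b * d) * d)               ≡⟨ cong +_ (lemma a b d) ⟩
    + ((a + b) * (d * d))                 ≡⟨ ℤ.pos-* (a + b) (d * d) ⟩
    + (a + b) ℤ.* + (d * d)               ∎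
    where open ≡.≡-Reasoning

-- The denominator has the shape `m * d` because `suc n !` unfolds to `suc n * n !`: this
-- cancellation makes differentiation shift the coefficients of an exponential generating function.
/-*-cancel : ∀ m a d .{{_ : NonZero m}} .{{_ : NonZero d}} .{{_ : NonZero (m * d)}} →
             (+ m / 1) ℚ.* (+ a / (m * d)) ≡ + a / d
/-*-cancel m@(suc m-1) a d@(suc d-1) =
  trans (fromℚᵘ-* (ℚᵘ.mkℚᵘ (+ m) 0) (ℚᵘ.mkℚᵘ (+ a) _))
        (ℚ.fromℚᵘ-cong {ℚᵘ.mkℚᵘ (+ m) 0 ℚᵘ.* ℚᵘ.mkℚᵘ (+ a) _} {ℚᵘ.mkℚᵘ (+ a) d-1} (ℚᵘ.*≡* eq))
  where
  lemma : ∀ m a d → m * a * d ≡ a * (1 * (m * d))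
  lemma = solve-∀
  eq : + m ℤ.* + a ℤ.* + d ≡ + a ℤ.* + (1 * (m * d))
  eq = begin
    + m ℤ.* + a ℤ.* + d        ≡⟨ cong (ℤ._* + d) (ℤ.pos-* m a) ⟨
    + (m * a) ℤ.* + d          ≡⟨ ℤ.pos-* (m * a) d ⟨
    + (m * a * d)              ≡⟨ cong +_ (lemma m a d) ⟩
    + (a * (1 * (m * d)))      ≡⟨ ℤ.pos-* a _ ⟩
    + a ℤ.* + (1 * (m * d))    ∎
    where open ≡.≡-Reasoning

module PowerSeriesProperties {c ℓ : Level} (R : ExponentialℚAlgebra c ℓ) where

  open ExponentialℚAlgebra R hiding (refl; sym; trans; zero; _≉_)
    renaming (Carrier to A; _+_ to _+ᴿ_; _*_ to _*ᴿ_)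
  private module R = ExponentialℚAlgebra R
  open PowerSeries R
  open RingMorphisms.IsRingHomomorphism fromℚ-isRingHomomorphism
    using (+-homo; *-homo; 0#-homo; 1#-homo)
  open MonoidMorphisms.IsMonoidHomomorphism e^-isMonoidHomomorphism
    using () renaming (homo to e^-+; ε-homo to e^-0; ⟦⟧-cong to e^-cong)
  open import Algebra.Properties.Ring ring using (-0#≈0#)
  open import Algebra.Properties.CommutativeSemigroup *-commutativeSemigroup using (x∙yz≈y∙xz)
  open import Algebra.Properties.CommutativeSemigroup +-commutativeSemigroup using (interchange)
  open import Algebra.Definitions.RawMonoid +-rawMonoid using (sum)
  open SetoidReasoning setoid

  ν : ℕ → A
  ν n = fromℚ (+ n / 1)

  ν-suc : ∀ n → ν (suc n) ≈ 1# +ᴿ ν n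
  ν-suc n = R.trans (R.reflexive (cong fromℚ (/-+ 1 n 1))) (R.trans (+-homo _ _) (+-congʳ 1#-homo))

  fromℚ-*-cancel : ∀ m a d .{{_ : NonZero m}} .{{_ : NonZero d}} .{{_ : NonZero (m * d)}} →
                   ν m *ᴿ fromℚ (+ a / (m * d)) ≈ fromℚ (+ a / d)
  fromℚ-*-cancel m a d = R.trans (R.sym (*-homo _ _)) (R.reflexive (cong fromℚ (/-*-cancel m a d)))

  1/ν : ℕ → A
  1/ν n = fromℚ (+ 1 / suc n)

  ν*1/ν : ∀ n → ν (suc n) *ᴿ 1/ν n ≈ 1#
  ν*1/ν n = begin
    ν (suc n) *ᴿ fromℚ (+ 1 / suc n)       ≡⟨ cong (λ z → ν (suc n) *ᴿ fromℚ z) (ℚ./-cong {p₁ = + 1} {q₁ = suc n} {q₂ = suc n * 1} refl (sym (ℕ.*-identityʳ (suc n)))) ⟩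
    ν (suc n) *ᴿ fromℚ (+ 1 / (suc n * 1)) ≈⟨ fromℚ-*-cancel (suc n) 1 1 ⟩
    fromℚ (+ 1 / 1)                        ≈⟨ 1#-homo ⟩
    1#                                     ∎

  -- Positive integers are invertible in a ℚ-algebra. Through `D-cancel`, a coefficient can thus be
  -- recovered from the derivative.
  ν-cancel : ∀ n {x y} → ν (suc n) *ᴿ x ≈ ν (suc n) *ᴿ y → x ≈ y
  ν-cancel n {x} {y} eq = begin
    x                         ≈⟨ lemma x ⟨
    1/ν n *ᴿ (ν (suc n) *ᴿ x) ≈⟨ *-congˡ eq ⟩
    1/ν n *ᴿ (ν (suc n) *ᴿ y) ≈⟨ lemma y ⟩
    y                         ∎
    where
    lemma : ∀ x → 1/ν n *ᴿ (ν (suc n) *ᴿ x) ≈ x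
    lemma x = begin
      1/ν n *ᴿ (ν (suc n) *ᴿ x) ≈⟨ *-assoc _ _ _ ⟨
      1/ν n *ᴿ ν (suc n) *ᴿ x   ≈⟨ *-congʳ (R.trans (*-comm _ _) (ν*1/ν n)) ⟩
      1# *ᴿ x                   ≈⟨ *-identityˡ x ⟩
      x                         ∎

  -- The formal derivative and the ring laws of series

  infixr 9 D_
  D_ : Series → Series
  (D F) n = ν (suc n) *ᴿ F (suc n)

  tail : Series → Series
  tail F n = F (suc n)

  infixr 8 _⋆_
  _⋆_ : A → Series → Series
  (a ⋆ F) n = a *ᴿ F n

  𝟘 : Series
  𝟘 _ = 0#

  D-cancel : ∀ F G n → (D F) n ≈ (D G) n → F (suc n) ≈ G (suc n)
  D-cancel F G n = ν-cancel n

  ≋-trans : ∀ {F G H} → F ≋ G → G ≋ H → F ≋ H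
  ≋-trans F≋G G≋H n = R.trans (F≋G n) (G≋H n)

  ≋-refl : ∀ {F} → F ≋ F
  ≋-refl n = R.refl

  D-cong : ∀ {F G} → F ≋ G → D F ≋ D G
  D-cong F≋G n = *-congˡ (F≋G (suc n))

  D-⊕ : ∀ F G → D (F ⊕ G) ≋ D F ⊕ D G
  D-⊕ F G n = distribˡ _ _ _

  -- Degree n of a product involves only degrees up to n of the factors. The bounded form serves
  -- inductions in which agreement is known only so far.
  ⊛-cong-≤ : ∀ {F F′ G G′} n → (∀ i → i ≤ n → F i ≈ F′ i) → (∀ i → i ≤ n → G i ≈ G′ i) →
             (F ⊛ G) n ≈ (F′ ⊛ G′) n
  ⊛-cong-≤ zero    F≈ G≈ = +-congʳ (*-cong (F≈ 0 z≤n) (G≈ 0 z≤n))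
  ⊛-cong-≤ (suc n) F≈ G≈ = +-cong (*-cong (F≈ 0 z≤n) (G≈ (suc n) ℕ.≤-refl))
    (⊛-cong-≤ n (λ i i≤n → F≈ (suc i) (s≤s i≤n)) (λ i i≤n → G≈ i (ℕ.m≤n⇒m≤1+n i≤n)))

  ⊛-cong : ∀ {F F′ G G′} → F ≋ F′ → G ≋ G′ → F ⊛ G ≋ F′ ⊛ G′
  ⊛-cong F≋ G≋ n = ⊛-cong-≤ n (λ i _ → F≋ i) (λ i _ → G≋ i)

  ⊛-congˡ : ∀ {F G G′} → G ≋ G′ → F ⊛ G ≋ F ⊛ G′
  ⊛-congˡ {F} {G} {G′} = ⊛-cong {F} {F} {G} {G′} ≋-refl

  ⊛-congʳ : ∀ {F F′ G} → F ≋ F′ → F ⊛ G ≋ F′ ⊛ G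
  ⊛-congʳ {F} {F′} {G} F≋ = ⊛-cong {F} {F′} {G} {G} F≋ ≋-refl

  ⊛-distribʳ : ∀ F G H → (G ⊕ H) ⊛ F ≋ G ⊛ F ⊕ H ⊛ F
  ⊛-distribʳ F G H zero    = R.trans (+-congʳ (distribʳ _ _ _))
    (R.trans (+-congˡ (R.sym (+-identityʳ _))) (interchange _ _ _ _))
  ⊛-distribʳ F G H (suc n) = R.trans (+-cong (distribʳ _ _ _) (⊛-distribʳ F (tail G) (tail H) n))
    (interchange _ _ _ _)

  ⋆-⊛ : ∀ a F G → (a ⋆ F) ⊛ G ≋ a ⋆ (F ⊛ G)
  ⋆-⊛ a F G zero    = R.trans (+-cong (*-assoc _ _ _) (R.sym (zeroʳ a))) (R.sym (distribˡ _ _ _))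
  ⋆-⊛ a F G (suc n) = R.trans (+-cong (*-assoc _ _ _) (⋆-⊛ a (tail F) G n)) (R.sym (distribˡ _ _ _))

  ⊛-zeroʳ-≤ : ∀ F {G} n → (∀ i → i ≤ n → G i ≈ 0#) → (F ⊛ G) n ≈ 0#
  ⊛-zeroʳ-≤ F zero    G≈0 = R.trans (+-identityʳ _) (R.trans (*-congˡ (G≈0 0 z≤n)) (zeroʳ _))
  ⊛-zeroʳ-≤ F (suc n) G≈0 = R.trans
    (+-cong (R.trans (*-congˡ (G≈0 (suc n) ℕ.≤-refl)) (zeroʳ _))
            (⊛-zeroʳ-≤ (tail F) n (λ i i≤n → G≈0 i (ℕ.m≤n⇒m≤1+n i≤n))))
    (+-identityˡ _)

  -- Induction on the degree through F = F 0 + x · `tail F`. The summand 1 in ν (n + 2) = 1 + ν (n +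
  -- 1) is what differentiating that factor x contributes; `tail-D` splits `tail (D F)` in the same
  -- way.
  leibniz : ∀ F G → D (F ⊛ G) ≋ D F ⊛ G ⊕ F ⊛ D G
  leibniz F G zero = begin
    ν 1 *ᴿ (F 0 *ᴿ G 1 +ᴿ (F 1 *ᴿ G 0 +ᴿ 0#))
      ≈⟨ R.trans (distribˡ _ _ _) (+-cong (x∙yz≈y∙xz _ _ _)
           (R.trans (distribˡ _ _ _) (+-cong (R.sym (*-assoc _ _ _)) (zeroʳ _)))) ⟩
    F 0 *ᴿ (ν 1 *ᴿ G 1) +ᴿ (ν 1 *ᴿ F 1 *ᴿ G 0 +ᴿ 0#)
      ≈⟨ R.trans (+-comm _ _) (+-congˡ (R.sym (+-identityʳ _))) ⟩
    (ν 1 *ᴿ F 1 *ᴿ G 0 +ᴿ 0#) +ᴿ (F 0 *ᴿ (ν 1 *ᴿ G 1) +ᴿ 0#) ∎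
  leibniz F G (suc n) = begin
    m *ᴿ (a +ᴿ p)
      ≈⟨ R.trans (distribˡ _ _ _) (+-cong (x∙yz≈y∙xz _ _ _) (R.trans (*-congʳ (ν-suc (suc n))) (distribʳ _ _ _))) ⟩
    a′ +ᴿ (1# *ᴿ p +ᴿ ν (suc n) *ᴿ p)
      ≈⟨ +-congˡ (+-cong (*-identityˡ p) (leibniz (tail F) G n)) ⟩
    a′ +ᴿ ((b +ᴿ q) +ᴿ ((D tail F ⊛ G) n +ᴿ r))
      ≈⟨ +-congˡ (R.trans (+-assoc _ _ _) (R.trans (+-congˡ (R.sym (+-assoc _ _ _))) (R.sym (+-assoc _ _ _)))) ⟩
    a′ +ᴿ (b +ᴿ (q +ᴿ (D tail F ⊛ G) n) +ᴿ r)
      ≈⟨ +-congˡ (+-congʳ (+-cong (*-congʳ (R.sym (R.trans (*-congʳ 1#-homo) (*-identityˡ _)))) (R.sym tail-D))) ⟩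
    a′ +ᴿ (b′ +ᴿ (tail (D F) ⊛ G) n +ᴿ r)
      ≈⟨ R.trans (R.sym (+-assoc _ _ _)) (R.trans (+-congʳ (+-comm _ _)) (+-assoc _ _ _)) ⟩
    b′ +ᴿ (tail (D F) ⊛ G) n +ᴿ (a′ +ᴿ r) ∎
    where
    m  = ν (suc (suc n))
    a  = F 0 *ᴿ G (suc (suc n))
    a′ = F 0 *ᴿ (m *ᴿ G (suc (suc n)))
    b  = F 1 *ᴿ G (suc n)
    b′ = (D F) 0 *ᴿ G (suc n)
    p  = (tail F ⊛ G) (suc n)
    q  = (tail (tail F) ⊛ G) n
    r  = (tail F ⊛ D G) n
    tail-D : (tail (D F) ⊛ G) n ≈ q +ᴿ (D tail F ⊛ G) n
    tail-D = R.trans (⊛-congʳ {F′ = tail (tail F) ⊕ D tail F} {G = G} (λ i → R.trans (*-congʳ (ν-suc (suc i)))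
                                 (R.trans (distribʳ _ _ _) (+-congʳ (*-identityˡ _)))) n)
                     (⊛-distribʳ G (tail (tail F)) (D tail F) n)

  -- The Leibniz rule reduces a ring law for the coefficient n + 1 to the same law for n.

  ⊛-comm : ∀ F G → F ⊛ G ≋ G ⊛ F
  ⊛-comm F G zero    = +-congʳ (*-comm _ _)
  ⊛-comm F G (suc n) = D-cancel (F ⊛ G) (G ⊛ F) n (begin
    (D (F ⊛ G)) n               ≈⟨ leibniz F G n ⟩
    (D F ⊛ G) n +ᴿ (F ⊛ D G) n  ≈⟨ +-cong (⊛-comm (D F) G n) (⊛-comm F (D G) n) ⟩
    (G ⊛ D F) n +ᴿ (D G ⊛ F) n  ≈⟨ +-comm _ _ ⟩
    (D G ⊛ F) n +ᴿ (G ⊛ D F) n  ≈⟨ leibniz G F n ⟨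
    (D (G ⊛ F)) n               ∎)

  ⊛-distribˡ : ∀ F G H → F ⊛ (G ⊕ H) ≋ F ⊛ G ⊕ F ⊛ H
  ⊛-distribˡ F G H n = R.trans (⊛-comm F (G ⊕ H) n) (R.trans (⊛-distribʳ F G H n)
    (+-cong (⊛-comm G F n) (⊛-comm H F n)))

  ⊛-assoc : ∀ F G H → (F ⊛ G) ⊛ H ≋ F ⊛ (G ⊛ H)
  ⊛-assoc F G H zero    = +-congʳ (R.trans (*-congʳ (+-identityʳ _)) (R.trans (*-assoc _ _ _) (*-congˡ (R.sym (+-identityʳ _)))))
  ⊛-assoc F G H (suc n) = D-cancel ((F ⊛ G) ⊛ H) (F ⊛ (G ⊛ H)) n (begin
    (D ((F ⊛ G) ⊛ H)) n
      ≈⟨ leibniz (F ⊛ G) H n ⟩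
    (D (F ⊛ G) ⊛ H) n +ᴿ ((F ⊛ G) ⊛ D H) n
      ≈⟨ +-congʳ (R.trans (⊛-congʳ {G = H} (leibniz F G) n) (⊛-distribʳ H (D F ⊛ G) (F ⊛ D G) n)) ⟩
    ((D F ⊛ G) ⊛ H) n +ᴿ ((F ⊛ D G) ⊛ H) n +ᴿ ((F ⊛ G) ⊛ D H) n
      ≈⟨ +-cong (+-cong (⊛-assoc (D F) G H n) (⊛-assoc F (D G) H n)) (⊛-assoc F G (D H) n) ⟩
    (D F ⊛ (G ⊛ H)) n +ᴿ (F ⊛ (D G ⊛ H)) n +ᴿ (F ⊛ (G ⊛ D H)) n
      ≈⟨ +-assoc _ _ _ ⟩
    (D F ⊛ (G ⊛ H)) n +ᴿ ((F ⊛ (D G ⊛ H)) n +ᴿ (F ⊛ (G ⊛ D H)) n)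
      ≈⟨ +-congˡ (R.trans (⊛-congˡ {F} (leibniz G H) n) (⊛-distribˡ F (D G ⊛ H) (G ⊛ D H) n)) ⟨
    (D F ⊛ (G ⊛ H)) n +ᴿ (F ⊛ D (G ⊛ H)) n
      ≈⟨ leibniz F (G ⊛ H) n ⟨
    (D (F ⊛ (G ⊛ H))) n ∎)

  ⊛-⋆ : ∀ a F G → F ⊛ (a ⋆ G) ≋ a ⋆ (F ⊛ G)
  ⊛-⋆ a F G n = R.trans (⊛-comm F (a ⋆ G) n) (R.trans (⋆-⊛ a G F n) (*-congˡ (⊛-comm G F n)))

  ⊛-zeroˡ : ∀ F → 𝟘 ⊛ F ≋ 𝟘
  ⊛-zeroˡ F n = R.trans (⊛-comm 𝟘 F n) (⊛-zeroʳ-≤ F n (λ _ _ → R.refl))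

  ⊛-identityˡ : ∀ F → 𝟙 ⊛ F ≋ F
  ⊛-identityˡ F zero    = R.trans (+-identityʳ _) (*-identityˡ _)
  ⊛-identityˡ F (suc n) = R.trans (+-cong (*-identityˡ _) (⊛-zeroˡ F n)) (+-identityʳ _)

  ⊛-left-comm : ∀ F G H → F ⊛ (G ⊛ H) ≋ G ⊛ (F ⊛ H)
  ⊛-left-comm F G H n = R.trans (R.sym (⊛-assoc F G H n))
    (R.trans (⊛-congʳ {G = H} (⊛-comm F G) n) (⊛-assoc G F H n))

  D-⋆ : ∀ a F → D (a ⋆ F) ≋ a ⋆ D F
  D-⋆ a F n = x∙yz≈y∙xz _ _ _

  D-∫ : ∀ F → D (∫₀ˣ F) ≋ F
  D-∫ F n = R.trans (R.sym (*-assoc _ _ _)) (R.trans (*-congʳ (ν*1/ν n)) (*-identityˡ _))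

  -- The equation expresses n + 1 times the coefficient of degree n + 1 through the coefficients up
  -- to degree n.
  ode-unique : ∀ K S {F G} → F 0 ≈ G 0 → D F ≋ K ⊛ F ⊕ S → D G ≋ K ⊛ G ⊕ S → F ≋ G
  ode-unique K S {F} {G} F0≈G0 DF DG n = upTo n n ℕ.≤-refl
    where
    -- The separate bound n turns strong induction into structural recursion.
    upTo : ∀ n i → i ≤ n → F i ≈ G i
    upTo n       zero    _         = F0≈G0
    upTo (suc n) (suc i) (s≤s i≤n) = D-cancel F G i (R.trans (DF i) (R.trans
      (+-congʳ (⊛-cong-≤ {K} {K} {F} {G} i (λ _ _ → R.refl) (λ j j≤i → upTo n j (ℕ.≤-trans j≤i i≤n))))
      (R.sym (DG i))))

  -- Powers and the exponential of a series

  Σ< : ℕ → (ℕ → A) → A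
  Σ< n f = sum {n} λ i → f (toℕ i)

  Σ<-cong : ∀ n {f g} → (∀ i → f i ≈ g i) → Σ< n f ≈ Σ< n g
  Σ<-cong zero    f≈g = R.refl
  Σ<-cong (suc n) f≈g = +-cong (f≈g 0) (Σ<-cong n (λ i → f≈g (suc i)))

  Σ<-stable : ∀ {m n} f → m ≤ n → (∀ i → m ≤ i → f i ≈ 0#) → Σ< n f ≈ Σ< m f
  Σ<-stable {n = zero}  f z≤n       f≈0 = R.refl
  Σ<-stable {n = suc n} f z≤n       f≈0 = R.trans
    (+-cong (f≈0 0 z≤n) (Σ<-stable {n = n} (λ i → f (suc i)) z≤n (λ i _ → f≈0 (suc i) z≤n))) (+-identityˡ _)
  Σ<-stable {suc m} {suc n} f (s≤s m≤n) f≈0 =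
    +-congˡ (Σ<-stable {m} {n} (λ i → f (suc i)) m≤n (λ i m≤i → f≈0 (suc i) (s≤s m≤i)))

  *-distribˡ-Σ< : ∀ n a f → a *ᴿ Σ< n f ≈ Σ< n (λ i → a *ᴿ f i)
  *-distribˡ-Σ< zero    a f = zeroʳ a
  *-distribˡ-Σ< (suc n) a f = R.trans (distribˡ _ _ _) (+-congˡ (*-distribˡ-Σ< n a (λ i → f (suc i))))

  ⊛-distribˡ-Σ< : ∀ n F (H : ℕ → Series) → F ⊛ (λ j → Σ< n λ m → H m j) ≋ λ j → Σ< n λ m → (F ⊛ H m) j
  ⊛-distribˡ-Σ< zero    F H j = ⊛-zeroʳ-≤ F j (λ _ _ → R.refl)
  ⊛-distribˡ-Σ< (suc n) F H j = R.trans (⊛-distribˡ F (H 0) (λ j → Σ< n λ m → H (suc m) j) j) (+-congˡ (⊛-distribˡ-Σ< n F (λ m → H (suc m)) j))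

  ^^-vanishes : ∀ G → G 0 ≈ 0# → ∀ m n → n < m → (G ^^ m) n ≈ 0#
  ^^-vanishes G G0≈0 (suc m) n (s≤s n≤m) = R.trans (⊛-comm G (G ^^ m) n) (go n n≤m)
    where
    go : ∀ n → n ≤ m → (G ^^ m ⊛ G) n ≈ 0#
    go zero    _   = R.trans (+-identityʳ _) (R.trans (*-congˡ G0≈0) (zeroʳ _))
    go (suc n) n<m = R.trans (⊛-comm (G ^^ m) G (suc n)) (R.trans
      (+-cong (R.trans (*-congʳ G0≈0) (zeroˡ _))
              (⊛-zeroʳ-≤ (tail G) n (λ i i≤n → ^^-vanishes G G0≈0 m i (ℕ.≤-<-trans i≤n n<m))))
      (+-identityˡ _))

  D-𝟙 : D 𝟙 ≋ 𝟘
  D-𝟙 n = zeroʳ _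

  D-^^ : ∀ G m → D (G ^^ suc m) ≋ ν (suc m) ⋆ (D G ⊛ G ^^ m)
  D-^^ G zero n = begin
    (D (G ⊛ 𝟙)) n                 ≈⟨ leibniz G 𝟙 n ⟩
    (D G ⊛ 𝟙) n +ᴿ (G ⊛ D 𝟙) n    ≈⟨ +-congˡ (⊛-zeroʳ-≤ G n (λ i _ → D-𝟙 i)) ⟩
    (D G ⊛ 𝟙) n +ᴿ 0#             ≈⟨ +-identityʳ _ ⟩
    (D G ⊛ 𝟙) n                   ≈⟨ *-identityˡ _ ⟨
    1# *ᴿ (D G ⊛ 𝟙) n             ≈⟨ *-congʳ 1#-homo ⟨
    ν 1 *ᴿ (D G ⊛ 𝟙) n            ∎
  D-^^ G (suc m) n = begin
    (D (G ⊛ G ^^ suc m)) n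
      ≈⟨ leibniz G (G ^^ suc m) n ⟩
    (D G ⊛ G ^^ suc m) n +ᴿ (G ⊛ D (G ^^ suc m)) n
      ≈⟨ +-congˡ (⊛-congˡ {G} (D-^^ G m) n) ⟩
    (D G ⊛ G ^^ suc m) n +ᴿ (G ⊛ ν (suc m) ⋆ (D G ⊛ G ^^ m)) n
      ≈⟨ +-cong (R.sym (*-identityˡ _)) (R.trans (⊛-⋆ (ν (suc m)) G (D G ⊛ G ^^ m) n) (*-congˡ (⊛-left-comm G (D G) (G ^^ m) n))) ⟩
    1# *ᴿ (D G ⊛ G ^^ suc m) n +ᴿ ν (suc m) *ᴿ (D G ⊛ G ^^ suc m) n
      ≈⟨ distribʳ _ _ _ ⟨
    (1# +ᴿ ν (suc m)) *ᴿ (D G ⊛ G ^^ suc m) n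
      ≈⟨ *-congʳ (ν-suc (suc m)) ⟨
    ν (suc (suc m)) *ᴿ (D G ⊛ G ^^ suc m) n ∎

  ν-*-! : ∀ a n → ν (suc n) *ᴿ fromℚ ((+ a / (suc n !)) {{suc n !≢0}}) ≈ fromℚ ((+ a / (n !)) {{n !≢0}})
  ν-*-! a n = fromℚ-*-cancel (suc n) a (n !)
    where instance _ = n !≢0
                   _ = suc n !≢0

  -- The factorial absorbs the factor m + 1 of the power rule, so differentiation merely lowers the
  -- index.
  D-divided-power : ∀ G m → D (1/ suc m ! • G ^^ suc m) ≋ D G ⊛ (1/ m ! • G ^^ m)
  D-divided-power G m n = begin
    (D (1/ suc m ! • G ^^ suc m)) n
      ≈⟨ D-⋆ (fromℚ (1/ suc m !)) (G ^^ suc m) n ⟩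
    fromℚ (1/ suc m !) *ᴿ (D (G ^^ suc m)) n
      ≈⟨ *-congˡ (D-^^ G m n) ⟩
    fromℚ (1/ suc m !) *ᴿ (ν (suc m) *ᴿ (D G ⊛ G ^^ m) n)
      ≈⟨ *-assoc _ _ _ ⟨
    fromℚ (1/ suc m !) *ᴿ ν (suc m) *ᴿ (D G ⊛ G ^^ m) n
      ≈⟨ *-congʳ (R.trans (*-comm _ _) (ν-*-! 1 m)) ⟩
    fromℚ (1/ m !) *ᴿ (D G ⊛ G ^^ m) n
      ≈⟨ ⊛-⋆ (fromℚ (1/ m !)) (D G) (G ^^ m) n ⟨
    (D G ⊛ (1/ m ! • G ^^ m)) n ∎

  exp-0 : ∀ F → exp F 0 ≈ e^ F 0
  exp-0 F = R.trans (*-congˡ (R.trans (+-identityʳ _) (R.trans (*-identityʳ _) 1#-homo))) (*-identityʳ _)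

  D-exp : ∀ F → D (exp F) ≋ D F ⊛ exp F
  D-exp F n = begin
    ν (suc n) *ᴿ (e *ᴿ (t 0 (suc n) +ᴿ Σ< (suc n) (λ m → t (suc m) (suc n))))
      ≈⟨ R.trans (x∙yz≈y∙xz _ _ _) (*-congˡ (*-congˡ (R.trans (+-congʳ (zeroʳ _)) (+-identityˡ _)))) ⟩
    e *ᴿ (ν (suc n) *ᴿ Σ< (suc n) (λ m → t (suc m) (suc n)))
      ≈⟨ *-congˡ (*-distribˡ-Σ< (suc n) (ν (suc n)) (λ m → t (suc m) (suc n))) ⟩
    e *ᴿ Σ< (suc n) (λ m → (D (t (suc m))) n)
      ≈⟨ *-congˡ (Σ<-cong (suc n) (λ m → D-divided-power G m n)) ⟩
    e *ᴿ Σ< (suc n) (λ m → (D G ⊛ t m) n)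
      ≈⟨ *-congˡ (⊛-distribˡ-Σ< (suc n) (D G) t n) ⟨
    e *ᴿ (D G ⊛ (λ j → Σ< (suc n) λ m → t m j)) n
      -- The sum in `exp` has a length that depends on the degree. At degree j ≤ n the terms with m
      -- > j vanish, as `G` has no constant term, so the common length n + 1 can be cut back to j +
      -- 1.
      ≈⟨ *-congˡ (⊛-cong-≤ n (λ i _ → DG≋DF i) (λ j j≤n → Σ<-stable (λ m → t m j) (s≤s j≤n) (vanish j))) ⟩
    e *ᴿ (D F ⊛ (λ j → Σ< (suc j) λ m → t m j)) n
      ≈⟨ ⊛-⋆ e (D F) (λ j → Σ< (suc j) λ m → t m j) n ⟨
    (D F ⊛ exp F) n ∎
    where
    e = e^ F 0
    G = F ⊖ const (F 0)
    t : ℕ → Series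
    t m = 1/ m ! • G ^^ m
    DG≋DF : D G ≋ D F
    DG≋DF n = *-congˡ (R.trans (+-congˡ -0#≈0#) (+-identityʳ _))
    vanish : ∀ j m → j < m → t m j ≈ 0#
    vanish j m j<m = R.trans (*-congˡ (^^-vanishes G (-‿inverseʳ _) m j j<m)) (zeroʳ _)

  -- Characterises `exp F` by its differential equation, so that congruence and the addition law
  -- follow without expanding the defining sum again.
  exp-unique : ∀ F {H} → H 0 ≈ e^ F 0 → D H ≋ D F ⊛ H → H ≋ exp F
  exp-unique F {H} H0 DH = ode-unique (D F) 𝟘 (R.trans H0 (R.sym (exp-0 F)))
    (λ n → R.trans (DH n) (R.sym (+-identityʳ _)))
    (λ n → R.trans (D-exp F n) (R.sym (+-identityʳ _)))

  exp-cong : ∀ {F G} → F ≋ G → exp F ≋ exp G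
  exp-cong {F} {G} F≋G = exp-unique G (R.trans (exp-0 F) (e^-cong (F≋G 0)))
    (λ n → R.trans (D-exp F n) (⊛-congʳ {D F} {D G} {exp F} (D-cong F≋G) n))

  exp-⊕ : ∀ F G → exp F ⊛ exp G ≋ exp (F ⊕ G)
  exp-⊕ F G = exp-unique (F ⊕ G)
    (R.trans (+-identityʳ _) (R.trans (*-cong (exp-0 F) (exp-0 G)) (R.sym (e^-+ _ _))))
    (λ n → begin
      (D (exp F ⊛ exp G)) n
        ≈⟨ leibniz (exp F) (exp G) n ⟩
      (D (exp F) ⊛ exp G) n +ᴿ (exp F ⊛ D (exp G)) n
        ≈⟨ +-cong (R.trans (⊛-congʳ {G = exp G} (D-exp F) n) (⊛-assoc (D F) (exp F) (exp G) n))
                  (R.trans (⊛-congˡ {exp F} (D-exp G) n) (⊛-left-comm (exp F) (D G) (exp G) n)) ⟩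
      (D F ⊛ (exp F ⊛ exp G)) n +ᴿ (D G ⊛ (exp F ⊛ exp G)) n
        ≈⟨ ⊛-distribʳ (exp F ⊛ exp G) (D F) (D G) n ⟨
      ((D F ⊕ D G) ⊛ (exp F ⊛ exp G)) n
        ≈⟨ ⊛-congʳ {G = exp F ⊛ exp G} (D-⊕ F G) n ⟨
      (D (F ⊕ G) ⊛ (exp F ⊛ exp G)) n ∎)

  D-X : D X ≋ 𝟙
  D-X zero    = R.trans (*-identityʳ _) 1#-homo
  D-X (suc n) = zeroʳ _

  D-X-⊛ : ∀ F → D X ⊛ F ≋ F
  D-X-⊛ F n = R.trans (⊛-congʳ {G = F} D-X n) (⊛-identityˡ F n)

  D-expX : D (exp X) ≋ exp X
  D-expX n = R.trans (D-exp X n) (D-X-⊛ (exp X) n)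

  expX-0 : exp X 0 ≈ 1#
  expX-0 = R.trans (exp-0 X) e^-0

  -- Exponential generating functions

  egf : (ℕ → ℕ) → Series
  egf f n = fromℚ (+ f n / (n !))
    where instance _ = n !≢0

  D-egf : ∀ f → D (egf f) ≋ egf (f ∘ suc)
  D-egf f n = ν-*-! (f (suc n)) n

  egf-cong : ∀ {f g} → (∀ n → f n ≡ g n) → egf f ≋ egf g
  egf-cong f≗g n = R.reflexive (cong (λ z → fromℚ (+ z / (n !))) (f≗g n))
    where instance _ = n !≢0

  egf-⊞ : ∀ f g → egf (f ⊞ g) ≋ egf f ⊕ egf g
  egf-⊞ f g n = R.trans (R.reflexive (cong fromℚ (/-+ (f n) (g n) (n !)))) (+-homo _ _)
    where instance _ = n !≢0

  -- Pascal's rule for the transform is the Leibniz rule with the factor e^x, which is its own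
  -- derivative. The induction treats all sequences at once, as its step also uses the shifted one.
  egf-binomial : ∀ f → egf (binomial f) ≋ exp X ⊛ egf f
  egf-binomial f zero    = R.sym (R.trans (+-identityʳ _) (R.trans (*-congʳ expX-0) (*-identityˡ _)))
  egf-binomial f (suc n) = D-cancel (egf (binomial f)) (exp X ⊛ egf f) n (begin
    (D (egf (binomial f))) n
      ≈⟨ D-egf (binomial f) n ⟩
    egf (binomial f ⊞ binomial (f ∘ suc)) n
      ≈⟨ egf-⊞ (binomial f) (binomial (f ∘ suc)) n ⟩
    egf (binomial f) n +ᴿ egf (binomial (f ∘ suc)) n
      ≈⟨ +-cong (egf-binomial f n) (egf-binomial (f ∘ suc) n) ⟩
    (exp X ⊛ egf f) n +ᴿ (exp X ⊛ egf (f ∘ suc)) n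
      ≈⟨ +-cong (⊛-congʳ {G = egf f} D-expX n) (⊛-congˡ {exp X} (D-egf f) n) ⟨
    (D (exp X) ⊛ egf f) n +ᴿ (exp X ⊛ D (egf f)) n
      ≈⟨ leibniz (exp X) (egf f) n ⟨
    (D (exp X ⊛ egf f)) n ∎)

  -- By Pascal's rule the derivative of column r + 1 of the triangle is that column plus column r,
  -- and the series x^r e^x / r! satisfy the same equations.
  egf-binomials : ∀ r → egf (binomials r) ≋ (1/ r ! • X ^^ r) ⊛ exp X
  egf-binomials zero n = begin
    egf (binomials 0) n
      ≈⟨ exp-unique X (R.trans 1#-homo (R.sym e^-0))
           (λ n → R.trans (D-egf (binomials 0) n) (R.sym (D-X-⊛ (egf (binomials 0)) n))) n ⟩
    exp X n
      ≈⟨ R.trans (*-congʳ 1#-homo) (*-identityˡ _) ⟨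
    fromℚ (1/ 0 !) *ᴿ exp X n
      ≈⟨ *-congˡ (⊛-identityˡ (exp X) n) ⟨
    fromℚ (1/ 0 !) *ᴿ (𝟙 ⊛ exp X) n
      ≈⟨ ⋆-⊛ (fromℚ (1/ 0 !)) 𝟙 (exp X) n ⟨
    ((1/ 0 ! • 𝟙) ⊛ exp X) n ∎
  egf-binomials (suc r) = ode-unique 𝟙 (egf (binomials r))
    (R.trans 0#-homo (R.sym (R.trans (+-identityʳ _) (R.trans
      (*-congʳ (R.trans (*-congˡ (^^-vanishes X R.refl (suc r) 0 (s≤s z≤n))) (zeroʳ _))) (zeroˡ _)))))
    (λ n → begin
      (D (egf (binomials (suc r)))) n
        ≈⟨ D-egf (binomials (suc r)) n ⟩
      egf (binomials (suc r) ⊞ binomials r) n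
        ≈⟨ egf-⊞ (binomials (suc r)) (binomials r) n ⟩
      egf (binomials (suc r)) n +ᴿ egf (binomials r) n
        ≈⟨ +-congʳ (⊛-identityˡ (egf (binomials (suc r))) n) ⟨
      (𝟙 ⊛ egf (binomials (suc r))) n +ᴿ egf (binomials r) n ∎)
    (λ n → begin
      (D (P (suc r) ⊛ exp X)) n
        ≈⟨ leibniz (P (suc r)) (exp X) n ⟩
      (D (P (suc r)) ⊛ exp X) n +ᴿ (P (suc r) ⊛ D (exp X)) n
        ≈⟨ +-cong (⊛-congʳ {G = exp X} (λ i → R.trans (D-divided-power X r i) (D-X-⊛ (P r) i)) n)
                  (⊛-congˡ {P (suc r)} D-expX n) ⟩
      (P r ⊛ exp X) n +ᴿ (P (suc r) ⊛ exp X) n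
        ≈⟨ +-comm _ _ ⟩
      (P (suc r) ⊛ exp X) n +ᴿ (P r ⊛ exp X) n
        ≈⟨ +-cong (R.sym (⊛-identityˡ (P (suc r) ⊛ exp X) n)) (R.sym (egf-binomials r n)) ⟩
      (𝟙 ⊛ (P (suc r) ⊛ exp X)) n +ᴿ egf (binomials r) n ∎)
    where
    P : ℕ → Series
    P m = 1/ m ! • X ^^ m

  -- The exponents e^x and e^x - 1 have the same derivative; the latter has constant term 0, which
  -- matches the value 1 at n = 0 through e^0 = 1.
  egf-homogeneous : ∀ f → f 0 ≡ 1 → (∀ n → f (suc n) ≡ binomial f n) → egf f ≋ exp (exp X ⊖ 𝟙)
  egf-homogeneous f f0 f-suc = exp-unique (exp X ⊖ 𝟙)
    (R.trans (R.reflexive (cong (λ z → fromℚ (+ z / 1)) f0)) (R.trans 1#-homo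
      (R.sym (R.trans (e^-cong (R.trans (+-congʳ expX-0) (-‿inverseʳ 1#))) e^-0))))
    (λ n → begin
      (D (egf f)) n             ≈⟨ D-egf f n ⟩
      egf (f ∘ suc) n           ≈⟨ egf-cong f-suc n ⟩
      egf (binomial f) n        ≈⟨ egf-binomial f n ⟩
      (exp X ⊛ egf f) n
        ≈⟨ ⊛-congʳ {D (exp X ⊖ 𝟙)} {exp X} {egf f}
             (λ i → R.trans (*-congˡ (R.trans (+-congˡ -0#≈0#) (+-identityʳ _))) (D-expX i)) n ⟨
      (D (exp X ⊖ 𝟙) ⊛ egf f) n ∎)

  -- Variation of constants: e^(e^x) solves the homogeneous equation, and the integrand is the
  -- forcing term divided by it, with the constant 1/r! kept outside the integral.
  egf-inhomogeneous : ∀ f r → f 0 ≡ 0 → (∀ n → f (suc n) ≡ binomial f n + binomials r n) → egf f ≋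
    (1/ r ! • exp (exp X)) ⊛ ∫₀ˣ (X ^^ r ⊛ exp (⊝ exp X ⊕ X))
  egf-inhomogeneous f r f0 f-suc = ode-unique (exp X) (egf (binomials r))
    (R.trans (R.reflexive (cong (λ z → fromℚ (+ z / 1)) f0)) (R.trans 0#-homo
      (R.sym (R.trans (+-identityʳ _) (zeroʳ _)))))
    (λ n → begin
      (D (egf f)) n
        ≈⟨ D-egf f n ⟩
      egf (f ∘ suc) n
        ≈⟨ egf-cong (f-suc) n ⟩
      egf (binomial f ⊞ binomials r) n
        ≈⟨ egf-⊞ (binomial f) (binomials r) n ⟩
      egf (binomial f) n +ᴿ egf (binomials r) n
        ≈⟨ +-congʳ (egf-binomial f n) ⟩
      (exp X ⊛ egf f) n +ᴿ egf (binomials r) n ∎)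
    (λ n → begin
      (D ((q ⋆ W) ⊛ I)) n
        ≈⟨ leibniz (q ⋆ W) I n ⟩
      (D (q ⋆ W) ⊛ I) n +ᴿ ((q ⋆ W) ⊛ D I) n
        ≈⟨ +-cong (R.trans (⊛-congʳ {G = I} D-qT n) (⊛-assoc (exp X) (q ⋆ W) I n))
                  (R.trans (⊛-congˡ {q ⋆ W} (D-∫ (X ^^ r ⊛ V)) n) (forcing n)) ⟩
      (exp X ⊛ ((q ⋆ W) ⊛ I)) n +ᴿ egf (binomials r) n ∎)
    where
    q = fromℚ (1/ r !)
    W = exp (exp X)
    V = exp (⊝ exp X ⊕ X)
    I = ∫₀ˣ (X ^^ r ⊛ V)
    D-qT : D (q ⋆ W) ≋ exp X ⊛ (q ⋆ W)
    D-qT n = begin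
      (D (q ⋆ W)) n          ≈⟨ D-⋆ q W n ⟩
      q *ᴿ (D W) n           ≈⟨ *-congˡ (R.trans (D-exp (exp X) n) (⊛-congʳ {G = W} D-expX n)) ⟩
      q *ᴿ (exp X ⊛ W) n     ≈⟨ ⊛-⋆ q (exp X) W n ⟨
      (exp X ⊛ (q ⋆ W)) n    ∎
    -- The constant terms e^1 and e^(-1), which need not be rational, cancel by the law for e^(a+b)
    -- inside `exp-⊕`.
    W⊛V : W ⊛ V ≋ exp X
    W⊛V n = R.trans (exp-⊕ (exp X) (⊝ exp X ⊕ X) n) (exp-cong {exp X ⊕ (⊝ exp X ⊕ X)} {X}
      (λ i → R.trans (R.sym (+-assoc _ _ _)) (R.trans (+-congʳ (-‿inverseʳ _)) (+-identityˡ _))) n)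
    forcing : (q ⋆ W) ⊛ (X ^^ r ⊛ V) ≋ egf (binomials r)
    forcing n = begin
      ((q ⋆ W) ⊛ (X ^^ r ⊛ V)) n     ≈⟨ ⋆-⊛ q W (X ^^ r ⊛ V) n ⟩
      q *ᴿ (W ⊛ (X ^^ r ⊛ V)) n      ≈⟨ *-congˡ (⊛-left-comm W (X ^^ r) V n) ⟩
      q *ᴿ (X ^^ r ⊛ (W ⊛ V)) n      ≈⟨ *-congˡ (⊛-congˡ {X ^^ r} W⊛V n) ⟩
      q *ᴿ (X ^^ r ⊛ exp X) n        ≈⟨ ⋆-⊛ q (X ^^ r) (exp X) n ⟨
      ((q ⋆ X ^^ r) ⊛ exp X) n       ≈⟨ egf-binomials r n ⟨
      egf (binomials r) n          ∎

-- The counting sequences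

open import Algebra.Properties.CommutativeSemigroup ℕ.+-commutativeSemigroup using (interchange; xy∙z≈xz∙y)
open import Data.Nat.Properties

binomial-cong : ∀ {f g} → f ≗ g → binomial f ≗ binomial g
binomial-cong f≗g zero    = f≗g 0
binomial-cong f≗g (suc n) = cong₂ _+_ (binomial-cong f≗g n) (binomial-cong (f≗g ∘ suc) n)

binomial-⊞ : ∀ f g → binomial (f ⊞ g) ≗ binomial f ⊞ binomial g
binomial-⊞ f g zero    = refl
binomial-⊞ f g (suc n) = trans
  (cong₂ _+_ (binomial-⊞ f g n) (binomial-⊞ (f ∘ suc) (g ∘ suc) n))
  (interchange (binomial f n) _ _ _)

binomial-0 : ∀ n → binomial (λ _ → 0) n ≡ 0
binomial-0 zero    = refl
binomial-0 (suc n) = cong₂ _+_ (binomial-0 n) (binomial-0 n)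

choose-cong : ∀ r {f g} → f ≗ g → choose r f ≗ choose r g
choose-cong zero    f≗g n       = f≗g n
choose-cong (suc r) f≗g zero    = refl
choose-cong (suc r) f≗g (suc n) = cong₂ _+_ (choose-cong (suc r) (f≗g ∘ suc) n) (choose-cong r f≗g n)

choose-⊞ : ∀ r f g → choose r (f ⊞ g) ≗ choose r f ⊞ choose r g
choose-⊞ zero    f g n       = refl
choose-⊞ (suc r) f g zero    = refl
choose-⊞ (suc r) f g (suc n) = trans
  (cong₂ _+_ (choose-⊞ (suc r) (f ∘ suc) (g ∘ suc) n) (choose-⊞ r f g n))
  (interchange (choose (suc r) (f ∘ suc) n) _ _ _)

-- On exponential generating functions the two operations are the multiplications by x^r / r! and by
-- e^x, which commute.
choose-binomial : ∀ r f → choose r (binomial f) ≗ binomial (choose r f)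
choose-binomial zero    f n       = refl
choose-binomial (suc r) f zero    = refl
choose-binomial (suc r) f (suc n) = begin
  choose (suc r) (binomial f ⊞ binomial (f ∘ suc)) n + choose r (binomial f) n
    ≡⟨ cong₂ _+_ (choose-⊞ (suc r) (binomial f) (binomial (f ∘ suc)) n) (choose-binomial r f n) ⟩
  choose (suc r) (binomial f) n + choose (suc r) (binomial (f ∘ suc)) n + binomial (choose r f) n
    ≡⟨ cong₂ _+_ (cong₂ _+_ (choose-binomial (suc r) f n) (choose-binomial (suc r) (f ∘ suc) n)) refl ⟩
  binomial (choose (suc r) f) n + binomial (choose (suc r) (f ∘ suc)) n + binomial (choose r f) n
    ≡⟨ +-assoc (binomial (choose (suc r) f) n) _ _ ⟩
  binomial (choose (suc r) f) n + (binomial (choose (suc r) (f ∘ suc)) n + binomial (choose r f) n)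
    ≡⟨ cong₂ _+_ refl (binomial-⊞ (choose (suc r) (f ∘ suc)) (choose r f) n) ⟨
  binomial (choose (suc r) f) n + binomial (choose (suc r) f ∘ suc) n ∎
  where open ≡-Reasoning

binomial-comm : ∀ (f : ℕ → ℕ → ℕ) m n →
                binomial (λ i → binomial (f i) n) m ≡ binomial (λ j → binomial (λ i → f i j) m) n
binomial-comm f zero    n = refl
binomial-comm f (suc m) n = trans
  (cong₂ _+_ (binomial-comm f m n) (binomial-comm (f ∘ suc) m n))
  (sym (binomial-⊞ _ _ n))

choose-0 : ∀ r n → choose r (λ _ → 0) n ≡ 0
choose-0 zero    n       = refl
choose-0 (suc r) zero    = refl
choose-0 (suc r) (suc n) = cong₂ _+_ (choose-0 (suc r) n) (choose-0 r n)

choose-binomialʳ : ∀ r (f : ℕ → ℕ → ℕ) m n →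
  choose r (λ i → binomial (f i) n) m ≡ binomial (λ j → choose r (λ i → f i j) m) n
choose-binomialʳ r f m zero    = refl
choose-binomialʳ r f m (suc n) = trans
  (choose-⊞ r _ _ m)
  (cong₂ _+_ (choose-binomialʳ r f m n) (choose-binomialʳ r (λ i → f i ∘ suc) m n))

-- Boundary value of `completions`: with no larger letter left no further run can start, so no
-- smaller letter may be left either.
δ₀ : ℕ → ℕ
δ₀ zero    = 1
δ₀ (suc _) = 0

-- completions s w counts the ways to continue an avoiding word that has just finished
-- a descending run, when s letters below its maximum and w letters above are unused:
-- either the smallest large letter is skipped, and joins the small ones, or it starts
-- the next run.

completions : ℕ → ℕ → ℕ
completions s zero    = δ₀ s
completions s (suc w) = completions (suc s) w + binomial (λ i → completions i w) s

-- Excludes the empty continuation, since the word must not end with its first run. A nonempty one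
-- starts with a larger letter, so only w = 0 is affected.
completions⁺ : ℕ → ℕ → ℕ
completions⁺ s zero    = 0
completions⁺ s (suc w) = completions s (suc w)

-- The avoiding words whose first descending run has length suc r and is not the whole
-- word, where the s smallest letters are excluded from being the first one.

firstRun : ℕ → ℕ → ℕ → ℕ
firstRun r s zero    = 0
firstRun r s (suc w) = firstRun r (suc s) w + choose r (λ i → completions⁺ i w) s

-- Multiplication by e^(x+y), for generating functions that are exponential in both indices.
binomial₂ : (ℕ → ℕ → ℕ) → ℕ → ℕ → ℕ
binomial₂ f s w = binomial (λ j → binomial (λ i → f i j) s) w

binomial-impulse : ∀ c n → binomial (λ i → δ₀ i * c) n ≡ c
binomial-impulse c zero    = *-identityˡ c
binomial-impulse c (suc n) = trans (cong₂ _+_ (binomial-impulse c n) (binomial-0 n)) (+-identityʳ c)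

-- For the generating functions G_w in y over s, the definition reads G_{w+1} = (d/dy + eʸ) G_w,
-- and d/dy + eʸ maps eʸ F to eʸ (F + (d/dy + eʸ) F); with Pascal's rule in w this is the step.

completions-suc : ∀ w s → completions s (suc w) ≡ binomial₂ completions s w
completions-suc zero    s = refl
completions-suc (suc w) s = begin
  completions (suc s) (suc w) + binomial (λ i → completions i (suc w)) s
    ≡⟨ cong₂ _+_ (completions-suc w (suc s)) (binomial-cong (completions-suc w) s) ⟩
  binomial₂ completions (suc s) w + binomial (λ i → binomial₂ completions i w) s
    ≡⟨ cong₂ _+_ (binomial-⊞ (λ j → binomial (λ i → completions i j) s) _ w)
                 (binomial-comm (λ i j → binomial (λ i → completions i j) i) s w) ⟩
  binomial₂ completions s w + binomial (λ j → binomial (λ i → completions (suc i) j) s) w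
    + binomial (λ j → binomial (binomial (λ i → completions i j)) s) w
    ≡⟨ +-assoc (binomial₂ completions s w) _ _ ⟩
  binomial₂ completions s w + (binomial (λ j → binomial (λ i → completions (suc i) j) s) w
    + binomial (λ j → binomial (binomial (λ i → completions i j)) s) w)
    ≡⟨ cong₂ _+_ refl (binomial-⊞ (λ j → binomial (λ i → completions (suc i) j) s) _ w) ⟨
  binomial₂ completions s w + binomial (λ j → binomial (λ i → completions (suc i) j) s
    + binomial (binomial (λ i → completions i j)) s) w
    ≡⟨ cong₂ _+_ refl (binomial-cong (λ j → binomial-⊞ (λ i → completions (suc i) j) _ s) w) ⟨
  binomial₂ completions s w + binomial (λ j → binomial (λ i → completions i (suc j)) s) w ∎
  where open ≡-Reasoning


binomial₂-cong : ∀ {f g : ℕ → ℕ → ℕ} → (∀ i j → f i j ≡ g i j) → ∀ s w → binomial₂ f s w ≡ binomial₂ g s w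
binomial₂-cong f≡g s w = binomial-cong (λ j → binomial-cong (λ i → f≡g i j) s) w

binomial₂-⊞ : ∀ f g s w → binomial₂ (λ i → f i ⊞ g i) s w ≡ binomial₂ f s w + binomial₂ g s w
binomial₂-⊞ f g s w = trans
  (binomial-cong (λ j → binomial-⊞ (λ i → f i j) (λ i → g i j) s) w)
  (binomial-⊞ (λ j → binomial (λ i → f i j) s) _ w)

-- Excluding the empty continuation removes an impulse at the state (0, 0), whose double transform
-- is 1. This 1 counts the continuation by a single run.
completions⁺-suc : ∀ w s → completions⁺ s (suc w) ≡ binomial₂ completions⁺ s w + 1
completions⁺-suc w s = begin
  completions s (suc w)
    ≡⟨ completions-suc w s ⟩
  binomial₂ completions s w
    ≡⟨ binomial₂-cong split s w ⟩
  binomial₂ (λ i → completions⁺ i ⊞ λ j → δ₀ i * δ₀ j) s w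
    ≡⟨ binomial₂-⊞ completions⁺ _ s w ⟩
  binomial₂ completions⁺ s w + binomial₂ (λ i j → δ₀ i * δ₀ j) s w
    ≡⟨ cong₂ _+_ refl (trans (binomial-cong (λ j → trans (binomial-impulse (δ₀ j) s) (sym (*-identityʳ (δ₀ j)))) w)
                          (binomial-impulse 1 w)) ⟩
  binomial₂ completions⁺ s w + 1 ∎
  where
  open ≡-Reasoning
  split : ∀ i j → completions i j ≡ completions⁺ i j + δ₀ i * δ₀ j
  split i zero    = sym (*-identityʳ (δ₀ i))
  split i (suc j) = sym (trans (cong₂ _+_ refl (*-zeroʳ (δ₀ i))) (+-identityʳ _))

choose-binomial₂ : ∀ r f s w → choose r (λ i → binomial₂ f i w) s ≡
                               binomial₂ (λ i j → choose r (λ i → f i j) i) s w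
choose-binomial₂ r f s w = trans
  (choose-binomialʳ r (λ i j → binomial (λ i → f i j) i) s w)
  (binomial-cong (λ j → choose-binomial r (λ i → f i j) s) w)

-- If the removed run is the second one, then the first consists of r + 1 of the w + s letters other
-- than the largest, not all among the s excluded ones. The negative part of this difference of
-- binomial coefficients is moved to the left to avoid subtraction; it is zero at s = 0.
firstRun-suc : ∀ r w s → firstRun r s (suc w) + binomials (suc r) s ≡
                         binomial₂ (firstRun r) s w + binomials (suc r) (w + s)
firstRun-suc r zero s = cong (_+ binomials (suc r) s) (trans (choose-0 r s) (sym (binomial-0 s)))
firstRun-suc r (suc w) s = begin
  firstRun r (suc s) (suc w) + choose r (λ i → completions⁺ i (suc w)) s + binomials (suc r) s
    ≡⟨ cong (λ z → firstRun r (suc s) (suc w) + z + binomials (suc r) s)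
            (trans (choose-cong r (completions⁺-suc w) s)
                   (trans (choose-⊞ r (λ i → binomial₂ completions⁺ i w) _ s)
                          (cong₂ _+_ (choose-binomial₂ r completions⁺ s w) refl))) ⟩
  firstRun r (suc s) (suc w) + (c + binomials r s) + binomials (suc r) s
    -- Pascal's rule holds by unfolding: `binomials (suc r) (suc s)` is `t :+ z`.
    ≡⟨ solve 4 (λ x y z t → x :+ (y :+ z) :+ t := x :+ (t :+ z) :+ y) refl
             (firstRun r (suc s) (suc w)) c (binomials r s) (binomials (suc r) s) ⟩
  firstRun r (suc s) (suc w) + binomials (suc r) (suc s) + c
    ≡⟨ cong (_+ c) (firstRun-suc r w (suc s)) ⟩
  binomial₂ (firstRun r) (suc s) w + binomials (suc r) (w + suc s) + c
    ≡⟨ cong (λ z → z + binomials (suc r) (w + suc s) + c) (binomial-⊞ (λ j → binomial (λ i → firstRun r i j) s) _ w) ⟩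
  a + b + binomials (suc r) (w + suc s) + c
    ≡⟨ solve 4 (λ x y z t → x :+ y :+ z :+ t := x :+ (y :+ t) :+ z) refl a b (binomials (suc r) (w + suc s)) c ⟩
  a + (b + c) + binomials (suc r) (w + suc s)
    ≡⟨ cong₂ (λ x y → a + x + binomials (suc r) y)
             (sym (binomial₂-⊞ (λ i → firstRun r (suc i)) (λ i j → choose r (λ i → completions⁺ i j) i) s w))
             (+-suc w s) ⟩
  a + binomial₂ (λ i j → firstRun r i (suc j)) s w + binomials (suc r) (suc w + s) ∎
  where
  open ≡-Reasoning
  open +-*-Solver
  a = binomial₂ (firstRun r) s w
  b = binomial₂ (λ i j → firstRun r (suc i) j) s w
  c = binomial₂ (λ i j → choose r (λ i → completions⁺ i j) i) s w

firstRun₀-suc : ∀ r n → firstRun r 0 (suc n) ≡ binomial (firstRun r 0) n + binomials (suc r) n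
firstRun₀-suc r n = trans (sym (+-identityʳ _))
  (trans (firstRun-suc r n 0) (cong (λ z → binomial (firstRun r 0) n + binomials (suc r) z) (+-identityʳ n)))

-- Sums over words and permutations

⟦_⟧ : Bool → ℕ
⟦ false ⟧ = 0
⟦ true  ⟧ = 1

⟦⟧-∧ : ∀ p q → ⟦ p ∧ q ⟧ ≡ ⟦ p ⟧ * ⟦ q ⟧
⟦⟧-∧ false q = refl
⟦⟧-∧ true  q = sym (+-identityʳ ⟦ q ⟧)

sumFin : ∀ n → (Fin n → ℕ) → ℕ
sumFin zero    φ = 0
sumFin (suc n) φ = φ fzero + sumFin n (φ ∘ fsuc)

sumFin-cong : ∀ n {φ ψ : Fin n → ℕ} → φ ≗ ψ → sumFin n φ ≡ sumFin n ψ
sumFin-cong zero    φ≗ψ = refl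
sumFin-cong (suc n) φ≗ψ = cong₂ _+_ (φ≗ψ fzero) (sumFin-cong n (φ≗ψ ∘ fsuc))

sumFin-0 : ∀ n → sumFin n (λ _ → 0) ≡ 0
sumFin-0 zero    = refl
sumFin-0 (suc n) = sumFin-0 n

sumFin-+ : ∀ n (φ ψ : Fin n → ℕ) → sumFin n (λ i → φ i + ψ i) ≡ sumFin n φ + sumFin n ψ
sumFin-+ zero    φ ψ = refl
sumFin-+ (suc n) φ ψ = trans (cong₂ _+_ refl (sumFin-+ n (φ ∘ fsuc) (ψ ∘ fsuc)))
  (interchange (φ fzero) _ _ _)

*-distribˡ-sumFin : ∀ n a (φ : Fin n → ℕ) → sumFin n (λ i → a * φ i) ≡ a * sumFin n φ
*-distribˡ-sumFin zero    a φ = sym (*-zeroʳ a)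
*-distribˡ-sumFin (suc n) a φ = trans (cong₂ _+_ refl (*-distribˡ-sumFin n a (φ ∘ fsuc)))
  (sym (*-distribˡ-+ a (φ fzero) _))

sumWords : ∀ m n → (Vec (Fin m) n → ℕ) → ℕ
sumWords m zero    Φ = Φ []
sumWords m (suc n) Φ = sumFin m λ a → sumWords m n λ w → Φ (a ∷ w)

sumWords-cong : ∀ m n {Φ Ψ : Vec (Fin m) n → ℕ} → Φ ≗ Ψ → sumWords m n Φ ≡ sumWords m n Ψ
sumWords-cong m zero    Φ≗Ψ = Φ≗Ψ []
sumWords-cong m (suc n) Φ≗Ψ = sumFin-cong m λ a → sumWords-cong m n λ w → Φ≗Ψ (a ∷ w)

*-distribˡ-sumWords : ∀ m n a (Φ : Vec (Fin m) n → ℕ) → sumWords m n (λ w → a * Φ w) ≡ a * sumWords m n Φ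
*-distribˡ-sumWords m zero    a Φ = refl
*-distribˡ-sumWords m (suc n) a Φ = trans
  (sumFin-cong m (λ b → *-distribˡ-sumWords m n a (λ w → Φ (b ∷ w))))
  (*-distribˡ-sumFin m a _)

sum-cartesianProduct : ∀ {A B C : Set} (f : A → B → C) (h : C → ℕ) n (g : Fin n → A) ys →
  ListAction.sum (List.map h (cartesianProductWith f (List.tabulate g) ys)) ≡
  sumFin n (λ i → ListAction.sum (List.map (λ y → h (f (g i) y)) ys))
sum-cartesianProduct f h zero    g ys = refl
sum-cartesianProduct f h (suc n) g ys = begin
  ListAction.sum (List.map h (xs ++ zs))
    ≡⟨ cong ListAction.sum (List.map-++ h xs zs) ⟩
  ListAction.sum (List.map h xs ++ List.map h zs)
    ≡⟨ ListAction.sum-++ (List.map h xs) (List.map h zs) ⟩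
  ListAction.sum (List.map h xs) + ListAction.sum (List.map h zs)
    ≡⟨ cong₂ _+_ (cong ListAction.sum (sym (List.map-∘ ys))) (sum-cartesianProduct f h n (g ∘ fsuc) ys) ⟩
  sumFin (suc n) (λ i → ListAction.sum (List.map (λ y → h (f (g i) y)) ys)) ∎
  where
  open ≡-Reasoning
  xs = List.map (f (g fzero)) ys
  zs = cartesianProductWith f (List.tabulate (g ∘ fsuc)) ys

sum-words : ∀ m n (Φ : Vec (Fin m) n → ℕ) → ListAction.sum (List.map Φ (words m n)) ≡ sumWords m n Φ
sum-words m zero    Φ = +-identityʳ (Φ [])
sum-words m (suc n) Φ = trans (sum-cartesianProduct _∷_ Φ m id (words m n))
  (sumFin-cong m (λ a → sum-words m n (λ w → Φ (a ∷ w))))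

length-filter-filter : ∀ {A : Set} {P Q : A → Set} (P? : Decidable P) (Q? : Decidable Q) xs →
  length (filter P? (filter Q? xs)) ≡ ListAction.sum (List.map (λ x → ⟦ does (Q? x) ⟧ * ⟦ does (P? x) ⟧) xs)
length-filter-filter P? Q? []       = refl
length-filter-filter P? Q? (x ∷ xs) with does (Q? x)
... | false = length-filter-filter P? Q? xs
... | true  with does (P? x)
...   | false = length-filter-filter P? Q? xs
...   | true  = cong suc (length-filter-filter P? Q? xs)

-- Distinct words and standardisation

fresh : ∀ {m n} → Fin m → Vec (Fin m) n → Bool
fresh a w = does (All.all? (λ b → ¬? (a Fin.≟ b)) w)

distinct : ∀ {m n} → Vec (Fin m) n → Bool
distinct w = does (allPairs? (λ a b → ¬? (a Fin.≟ b)) w)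

≟-punchIn : ∀ {n} (i : Fin (suc n)) j k → does (punchIn i j Fin.≟ punchIn i k) ≡ does (j Fin.≟ k)
≟-punchIn i j k = does-⇔ (mk⇔ (Fin.punchIn-injective i j k) (cong (punchIn i)))
  (punchIn i j Fin.≟ punchIn i k) (j Fin.≟ k)

fresh-punchIn : ∀ {m n} (i : Fin (suc m)) a (w : Vec (Fin m) n) →
                fresh (punchIn i a) (Vec.map (punchIn i) w) ≡ fresh a w
fresh-punchIn i a []      = refl
fresh-punchIn i a (b ∷ w) = cong₂ _∧_ (cong not (≟-punchIn i a b)) (fresh-punchIn i a w)

distinct-punchIn : ∀ {m n} (i : Fin (suc m)) (w : Vec (Fin m) n) →
                   distinct (Vec.map (punchIn i) w) ≡ distinct w
distinct-punchIn i []      = refl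
distinct-punchIn i (a ∷ w) = cong₂ _∧_ (fresh-punchIn i a w) (distinct-punchIn i w)

sumFin-punchIn : ∀ n (a : Fin (suc n)) (φ : Fin (suc n) → ℕ) →
  sumFin (suc n) (λ b → ⟦ not (does (a Fin.≟ b)) ⟧ * φ b) ≡ sumFin n (φ ∘ punchIn a)
sumFin-punchIn n       fzero    φ = sumFin-cong n (λ b → +-identityʳ _)
sumFin-punchIn (suc n) (fsuc a) φ = cong₂ _+_ (+-identityʳ _) (sumFin-punchIn n a (φ ∘ fsuc))

sumWords-fresh : ∀ m n (a : Fin (suc m)) (Φ : Vec (Fin (suc m)) n → ℕ) →
  sumWords (suc m) n (λ w → ⟦ fresh a w ⟧ * Φ w) ≡ sumWords m n (Φ ∘ Vec.map (punchIn a))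
sumWords-fresh m zero    a Φ = +-identityʳ _
sumWords-fresh m (suc n) a Φ = begin
  sumFin (suc m) (λ b → sumWords (suc m) n λ w → ⟦ not (does (a Fin.≟ b)) ∧ fresh a w ⟧ * Φ (b ∷ w))
    ≡⟨ sumFin-cong (suc m) (λ b → trans
         (sumWords-cong (suc m) n (λ w → trans
           (cong (_* Φ (b ∷ w)) (⟦⟧-∧ (not (does (a Fin.≟ b))) (fresh a w)))
           (*-assoc ⟦ not (does (a Fin.≟ b)) ⟧ _ _)))
         (*-distribˡ-sumWords (suc m) n ⟦ not (does (a Fin.≟ b)) ⟧ _)) ⟩
  sumFin (suc m) (λ b → ⟦ not (does (a Fin.≟ b)) ⟧ * sumWords (suc m) n λ w → ⟦ fresh a w ⟧ * Φ (b ∷ w))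
    ≡⟨ sumFin-punchIn m a (λ b → sumWords (suc m) n λ w → ⟦ fresh a w ⟧ * Φ (b ∷ w)) ⟩
  sumFin m (λ b → sumWords (suc m) n λ w → ⟦ fresh a w ⟧ * Φ (punchIn a b ∷ w))
    ≡⟨ sumFin-cong m (λ b → sumWords-fresh m n a (λ w → Φ (punchIn a b ∷ w))) ⟩
  sumFin m (λ b → sumWords m n λ w → Φ (punchIn a b ∷ Vec.map (punchIn a) w)) ∎
  where open ≡-Reasoning

-- A permutation is its first letter followed by the standardisation of the rest.

extend : ∀ {m n} → Fin (suc m) → Vec (Fin m) n → Vec (Fin (suc m)) (suc n)
extend a w = a ∷ Vec.map (punchIn a) w

sumPerms : ∀ n → (Vec (Fin n) n → ℕ) → ℕ
sumPerms zero    Φ = Φ []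
sumPerms (suc n) Φ = sumFin (suc n) λ a → sumPerms n (Φ ∘ extend a)

sumPerms-cong : ∀ n {Φ Ψ : Vec (Fin n) n → ℕ} → Φ ≗ Ψ → sumPerms n Φ ≡ sumPerms n Ψ
sumPerms-cong zero    Φ≗Ψ = Φ≗Ψ []
sumPerms-cong (suc n) Φ≗Ψ = sumFin-cong (suc n) λ a → sumPerms-cong n (Φ≗Ψ ∘ extend a)

sumPerms-+ : ∀ n (Φ Ψ : Vec (Fin n) n → ℕ) → sumPerms n (λ w → Φ w + Ψ w) ≡ sumPerms n Φ + sumPerms n Ψ
sumPerms-+ zero    Φ Ψ = refl
sumPerms-+ (suc n) Φ Ψ = trans (sumFin-cong (suc n) (λ a → sumPerms-+ n (Φ ∘ extend a) (Ψ ∘ extend a)))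
  (sumFin-+ (suc n) (λ a → sumPerms n (Φ ∘ extend a)) (λ a → sumPerms n (Ψ ∘ extend a)))

*-distribˡ-sumPerms : ∀ n a (Φ : Vec (Fin n) n → ℕ) → sumPerms n (λ w → a * Φ w) ≡ a * sumPerms n Φ
*-distribˡ-sumPerms zero    a Φ = refl
*-distribˡ-sumPerms (suc n) a Φ = trans
  (sumFin-cong (suc n) (λ b → *-distribˡ-sumPerms n a (Φ ∘ extend b)))
  (*-distribˡ-sumFin (suc n) a (λ b → sumPerms n (Φ ∘ extend b)))

-- A letter different from a is uniquely `punchIn a b`, and this relabelling preserves distinctness.
-- So filtering all words becomes a recursion on the first letter.
sumWords-distinct : ∀ n (Φ : Vec (Fin n) n → ℕ) →
  sumWords n n (λ w → ⟦ distinct w ⟧ * Φ w) ≡ sumPerms n Φ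
sumWords-distinct zero    Φ = +-identityʳ _
sumWords-distinct (suc n) Φ = sumFin-cong (suc n) λ a → begin
  sumWords (suc n) n (λ w → ⟦ fresh a w ∧ distinct w ⟧ * Φ (a ∷ w))
    ≡⟨ sumWords-cong (suc n) n (λ w → trans
         (cong (_* Φ (a ∷ w)) (⟦⟧-∧ (fresh a w) (distinct w))) (*-assoc ⟦ fresh a w ⟧ _ _)) ⟩
  sumWords (suc n) n (λ w → ⟦ fresh a w ⟧ * (⟦ distinct w ⟧ * Φ (a ∷ w)))
    ≡⟨ sumWords-fresh n n a (λ w → ⟦ distinct w ⟧ * Φ (a ∷ w)) ⟩
  sumWords n n (λ w → ⟦ distinct (Vec.map (punchIn a) w) ⟧ * Φ (extend a w))
    ≡⟨ sumWords-cong n n (λ w → cong (λ z → ⟦ z ⟧ * Φ (extend a w)) (distinct-punchIn a w)) ⟩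
  sumWords n n (λ w → ⟦ distinct w ⟧ * Φ (extend a w))
    ≡⟨ sumWords-distinct n (Φ ∘ extend a) ⟩
  sumPerms n (Φ ∘ extend a) ∎
  where open ≡-Reasoning

-- x and y are the thresholds below which a letter is smaller than the preceding letter,
-- respectively than the maximum so far.

run : ∀ {m n} → ℕ → ℕ → Vec (Fin m) n → Bool
run x y []      = true
run x y (b ∷ w) = ((toℕ b <ᵇ x) ∧ run (toℕ b) y w) ∨ (not (toℕ b <ᵇ y) ∧ run (toℕ b) (toℕ b) w)

-- The test behind `firstRun`: r further letters belong to the first run and the next one opens the
-- second. It fails on the empty word because that second run has to exist.
runAfter : ∀ {m n} → ℕ → ℕ → ℕ → Vec (Fin m) n → Bool
runAfter r       x y []      = false
runAfter zero    x y (b ∷ w) = not (toℕ b <ᵇ y) ∧ run (toℕ b) (toℕ b) w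
runAfter (suc r) x y (b ∷ w) = (toℕ b <ᵇ x) ∧ runAfter r (toℕ b) y w

runFrom : ∀ {m n} → ℕ → ℕ → Vec (Fin m) n → Bool
runFrom r s []      = false
runFrom r s (b ∷ w) = not (toℕ b <ᵇ s) ∧ runAfter r (toℕ b) (toℕ b) w

-- The threshold t after the letter b has been removed from the alphabet.

lower : ℕ → ℕ → ℕ
lower b       zero    = zero
lower zero    (suc t) = t
lower (suc b) (suc t) = suc (lower b t)

lower-diag : ∀ b → lower b b ≡ b
lower-diag zero    = refl
lower-diag (suc b) = cong suc (lower-diag b)

lower-+ : ∀ b v → lower b (suc (b + v)) ≡ b + v
lower-+ zero    v = refl
lower-+ (suc b) v = cong suc (lower-+ b v)

lower-punchIn : ∀ {n} (b : Fin (suc n)) c → lower (toℕ b) (toℕ (punchIn b c)) ≡ toℕ c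
lower-punchIn fzero    c        = refl
lower-punchIn (fsuc b) fzero    = refl
lower-punchIn (fsuc b) (fsuc c) = cong suc (lower-punchIn b c)

punchIn-<ᵇ : ∀ {n} (b : Fin (suc n)) c t → (toℕ (punchIn b c) <ᵇ t) ≡ (toℕ c <ᵇ lower (toℕ b) t)
punchIn-<ᵇ b        c        zero    = refl
punchIn-<ᵇ fzero    c        (suc t) = refl
punchIn-<ᵇ (fsuc b) fzero    (suc t) = refl
punchIn-<ᵇ (fsuc b) (fsuc c) (suc t) = punchIn-<ᵇ b c t

run-punchIn : ∀ {m n} (b : Fin (suc m)) x y (w : Vec (Fin m) n) →
  run x y (Vec.map (punchIn b) w) ≡ run (lower (toℕ b) x) (lower (toℕ b) y) w
run-punchIn b x y []      = refl
run-punchIn b x y (c ∷ w)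
  rewrite punchIn-<ᵇ b c x | punchIn-<ᵇ b c y
        | run-punchIn b (toℕ (punchIn b c)) y w
        | run-punchIn b (toℕ (punchIn b c)) (toℕ (punchIn b c)) w
        | lower-punchIn b c = refl

runAfter-punchIn : ∀ {m n} r (b : Fin (suc m)) x y (w : Vec (Fin m) n) →
  runAfter r x y (Vec.map (punchIn b) w) ≡ runAfter r (lower (toℕ b) x) (lower (toℕ b) y) w
runAfter-punchIn r       b x y []      = refl
runAfter-punchIn zero    b x y (c ∷ w)
  rewrite punchIn-<ᵇ b c y
        | run-punchIn b (toℕ (punchIn b c)) (toℕ (punchIn b c)) w
        | lower-punchIn b c = refl
runAfter-punchIn (suc r) b x y (c ∷ w)
  rewrite punchIn-<ᵇ b c x
        | runAfter-punchIn r b (toℕ (punchIn b c)) y w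
        | lower-punchIn b c = refl

-- Counting runs by the first letter

below above : ℕ → ℕ → (ℕ → ℕ) → ℕ
below n x φ = sumFin n λ b → ⟦ toℕ b <ᵇ x ⟧ * φ (toℕ b)
above n y φ = sumFin n λ b → ⟦ not (toℕ b <ᵇ y) ⟧ * φ (toℕ b)

below-suc : ∀ {n x} φ → x < n → below n (suc x) φ ≡ below n x φ + φ x
below-suc {suc n} {zero}  φ _         = trans (+-comm (1 * φ 0) _) (cong₂ _+_ refl (+-identityʳ (φ 0)))
below-suc {suc n} {suc x} φ (s≤s x<n) = trans
  (cong₂ _+_ refl (below-suc (φ ∘ suc) x<n)) (sym (+-assoc (1 * φ 0) _ _))

above-suc : ∀ {n y} φ → y < n → above n y φ ≡ above n (suc y) φ + φ y
above-suc {suc n} {zero}  φ _         = trans (+-comm (1 * φ 0) _) (cong₂ _+_ refl (+-identityʳ (φ 0)))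
above-suc {suc n} {suc y} φ (s≤s y<n) = above-suc (φ ∘ suc) y<n

above-full : ∀ n φ → above n n φ ≡ 0
above-full zero    φ = refl
above-full (suc n) φ = above-full n (φ ∘ suc)


below-0 : ∀ n φ → below n 0 φ ≡ 0
below-0 n φ = sumFin-0 n

runs : ℕ → ℕ → ℕ → ℕ
runs n x y = sumPerms n λ w → ⟦ run x y w ⟧

runsAfter : ℕ → ℕ → ℕ → ℕ → ℕ
runsAfter r n x y = sumPerms n λ w → ⟦ runAfter r x y w ⟧

runsFrom : ℕ → ℕ → ℕ → ℕ
runsFrom r n s = sumPerms n λ w → ⟦ runFrom r s w ⟧

<ᵇ-mono : ∀ b {x y} → x ≤ y → (b <ᵇ x) ≡ true → (b <ᵇ y) ≡ true
<ᵇ-mono zero    (s≤s _)   _  = refl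
<ᵇ-mono (suc b) (s≤s x≤y) eq = <ᵇ-mono b x≤y eq

-- The implication makes the two alternatives of `run` exclusive, so that their disjunction is
-- counted by a sum.
⟦⟧-exclusive : ∀ p q r s → (p ≡ true → r ≡ true) →
  ⟦ (p ∧ q) ∨ (not r ∧ s) ⟧ ≡ ⟦ p ⟧ * ⟦ q ⟧ + ⟦ not r ⟧ * ⟦ s ⟧
⟦⟧-exclusive false q r     s p⇒r = ⟦⟧-∧ (not r) s
⟦⟧-exclusive true  q false s p⇒r with () ← p⇒r refl
⟦⟧-exclusive true  q true  s p⇒r = trans (cong ⟦_⟧ (∨-identityʳ q))
  (trans (sym (+-identityʳ ⟦ q ⟧)) (sym (+-identityʳ _)))

sumPerms-guard : ∀ n p (ρ : Vec (Fin n) n → Bool) →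
  sumPerms n (λ w → ⟦ p ∧ ρ w ⟧) ≡ ⟦ p ⟧ * sumPerms n (λ w → ⟦ ρ w ⟧)
sumPerms-guard n p ρ = trans (sumPerms-cong n (λ w → ⟦⟧-∧ p (ρ w))) (*-distribˡ-sumPerms n ⟦ p ⟧ _)

runs-suc : ∀ n {x y} → x ≤ y →
  runs (suc n) x y ≡ below (suc n) x (λ b → runs n b (lower b y)) + above (suc n) y (λ b → runs n b b)
runs-suc n {x} {y} x≤y = trans (sumFin-cong (suc n) first)
  (sumFin-+ (suc n) (λ a → ⟦ toℕ a <ᵇ x ⟧ * runs n (toℕ a) (lower (toℕ a) y))
                    (λ a → ⟦ not (toℕ a <ᵇ y) ⟧ * runs n (toℕ a) (toℕ a)))
  where
  open ≡-Reasoning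
  first : ∀ (a : Fin (suc n)) → let b = toℕ a in
    sumPerms n (λ w → ⟦ run x y (extend a w) ⟧) ≡
    ⟦ b <ᵇ x ⟧ * runs n b (lower b y) + ⟦ not (b <ᵇ y) ⟧ * runs n b b
  first a = begin
    sumPerms n (λ w → ⟦ run x y (extend a w) ⟧)
      ≡⟨ sumPerms-cong n (λ w → cong₂ (λ p q → ⟦ ((b <ᵇ x) ∧ p) ∨ (not (b <ᵇ y) ∧ q) ⟧)
           (trans (run-punchIn a b y w) (cong (λ z → run z (lower b y) w) (lower-diag b)))
           (trans (run-punchIn a b b w) (cong (λ z → run z z w) (lower-diag b)))) ⟩
    sumPerms n (λ w → ⟦ ((b <ᵇ x) ∧ run b (lower b y) w) ∨ (not (b <ᵇ y) ∧ run b b w) ⟧)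
      ≡⟨ sumPerms-cong n (λ w → ⟦⟧-exclusive (b <ᵇ x) _ (b <ᵇ y) _ (<ᵇ-mono b x≤y)) ⟩
    sumPerms n (λ w → ⟦ b <ᵇ x ⟧ * ⟦ run b (lower b y) w ⟧ + ⟦ not (b <ᵇ y) ⟧ * ⟦ run b b w ⟧)
      ≡⟨ sumPerms-+ n (λ w → ⟦ b <ᵇ x ⟧ * ⟦ run b (lower b y) w ⟧) _ ⟩
    sumPerms n (λ w → ⟦ b <ᵇ x ⟧ * ⟦ run b (lower b y) w ⟧) + sumPerms n (λ w → ⟦ not (b <ᵇ y) ⟧ * ⟦ run b b w ⟧)
      ≡⟨ cong₂ _+_ (*-distribˡ-sumPerms n ⟦ b <ᵇ x ⟧ _) (*-distribˡ-sumPerms n ⟦ not (b <ᵇ y) ⟧ _) ⟩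
    ⟦ b <ᵇ x ⟧ * runs n b (lower b y) + ⟦ not (b <ᵇ y) ⟧ * runs n b b ∎
    where b = toℕ a

runsAfter-suc : ∀ r n x y → runsAfter (suc r) (suc n) x y ≡ below (suc n) x (λ b → runsAfter r n b (lower b y))
runsAfter-suc r n x y = sumFin-cong (suc n) λ a → let b = toℕ a in trans
  (sumPerms-cong n (λ w → cong (λ p → ⟦ (b <ᵇ x) ∧ p ⟧)
    (trans (runAfter-punchIn r a b y w) (cong (λ z → runAfter r z (lower b y) w) (lower-diag b)))))
  (sumPerms-guard n (b <ᵇ x) _)

runsFrom-suc : ∀ r n s → runsFrom r (suc n) s ≡ above (suc n) s (λ b → runsAfter r n b b)
runsFrom-suc r n s = sumFin-cong (suc n) λ a → let b = toℕ a in trans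
  (sumPerms-cong n (λ w → cong (λ p → ⟦ not (b <ᵇ s) ∧ p ⟧)
    (trans (runAfter-punchIn r a b b w) (cong (λ z → runAfter r z z w) (lower-diag b)))))
  (sumPerms-guard n (not (b <ᵇ s)) _)

runs₀-suc : ∀ n y → runs (suc n) 0 y ≡ above (suc n) y (λ b → runs n b b)
runs₀-suc n y = trans (runs-suc n {0} {y} z≤n)
  (cong (_+ above (suc n) y (λ b → runs n b b)) (below-0 (suc n) (λ b → runs n b (lower b y))))

runs-full : ∀ n → runs n 0 n ≡ δ₀ n
runs-full zero    = refl
runs-full (suc n) = trans (runs₀-suc n (suc n)) (above-full (suc n) (λ b → runs n b b))

runs-skip : ∀ {n s} → s < suc n → runs (suc n) 0 s ≡ runs (suc n) 0 (suc s) + runs n s s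
runs-skip {n} {s} s<n = begin
  runs (suc n) 0 s
    ≡⟨ runs₀-suc n s ⟩
  above (suc n) s (λ b → runs n b b)
    ≡⟨ above-suc (λ b → runs n b b) s<n ⟩
  above (suc n) (suc s) (λ b → runs n b b) + runs n s s
    ≡⟨ cong (_+ runs n s s) (runs₀-suc n (suc s)) ⟨
  runs (suc n) 0 (suc s) + runs n s s ∎
  where open ≡-Reasoning

runs-descend : ∀ {n x y} → x < suc n → x < y → runs (suc n) (suc x) y ≡ runs (suc n) x y + runs n x (lower x y)
runs-descend {n} {x} {y} x<n x<y = begin
  runs (suc n) (suc x) y
    ≡⟨ trans (runs-suc n x<y) (cong (_+ A) (below-suc φ x<n)) ⟩
  below (suc n) x φ + φ x + A
    ≡⟨ xy∙z≈xz∙y (below (suc n) x φ) (φ x) A ⟩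
  below (suc n) x φ + A + φ x
    ≡⟨ cong (_+ φ x) (runs-suc n (<⇒≤ x<y)) ⟨
  runs (suc n) x y + φ x ∎
  where
  open ≡-Reasoning
  φ = λ b → runs n b (lower b y)
  A = above (suc n) y (λ b → runs n b b)

-- Below the last letter of the run lie u letters, between it and the maximum v. The largest of the
-- u letters is either passed over and joins the v letters, or comes next: this is Pascal's rule in
-- `binomial`. At u = 0 the run is over and `hyp` applies.
runs-descending : ∀ w → (∀ s n → n ≡ s + w → runs n 0 s ≡ completions s w) →
  ∀ u v n → n ≡ u + v + w → runs n u (u + v) ≡ binomial (λ i → completions (v + i) w) u
runs-descending w hyp zero    v n       eq = trans (hyp v n eq) (cong (λ z → completions z w) (sym (+-identityʳ v)))
runs-descending w hyp (suc u) v (suc n) eq = begin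
  runs (suc n) (suc u) (suc (u + v))
    ≡⟨ runs-descend (subst (u <_) (sym eq) (s≤s (≤-trans (m≤m+n u v) (m≤m+n (u + v) w)))) (s≤s (m≤m+n u v)) ⟩
  runs (suc n) u (suc (u + v)) + runs n u (lower u (suc (u + v)))
    ≡⟨ cong₂ (λ y z → runs (suc n) u y + runs n u z) (sym (+-suc u v)) (lower-+ u v) ⟩
  runs (suc n) u (u + suc v) + runs n u (u + v)
    ≡⟨ cong₂ _+_ (runs-descending w hyp u (suc v) (suc n) (trans eq (cong (_+ w) (sym (+-suc u v)))))
                 (runs-descending w hyp u v n (suc-injective eq)) ⟩
  binomial (λ i → completions (suc v + i) w) u + binomial (λ i → completions (v + i) w) u
    ≡⟨ +-comm (binomial (λ i → completions (suc v + i) w) u) _ ⟩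
  binomial (λ i → completions (v + i) w) u + binomial (λ i → completions (suc v + i) w) u
    ≡⟨ cong₂ _+_ refl (binomial-cong (λ i → cong (λ z → completions z w) (sym (+-suc v i))) u) ⟩
  binomial (λ i → completions (v + i) w) (suc u) ∎
  where open ≡-Reasoning

runs≡completions : ∀ w s n → n ≡ s + w → runs n 0 s ≡ completions s w
runs≡completions zero    s n       eq = trans (cong (λ z → runs n 0 z) (sym n≡s)) (trans (runs-full n) (cong δ₀ n≡s))
  where
  n≡s : n ≡ s
  n≡s = trans eq (+-identityʳ s)
runs≡completions (suc w) s zero    eq with () ← trans eq (+-suc s w)
runs≡completions (suc w) s (suc n) eq = begin
  runs (suc n) 0 s
    ≡⟨ runs-skip (subst (s <_) (sym eq′) (s≤s (m≤m+n s w))) ⟩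
  runs (suc n) 0 (suc s) + runs n s s
    -- The letter that opens a run is the new maximum, so no letter lies between the two: v = 0.
    ≡⟨ cong₂ _+_ (runs≡completions w (suc s) (suc n) eq′)
                 (trans (cong (runs n s) (sym (+-identityʳ s)))
                        (runs-descending w (runs≡completions w) s 0 n
                          (trans (suc-injective eq′) (cong (_+ w) (sym (+-identityʳ s)))))) ⟩
  completions s (suc w) ∎
  where
  open ≡-Reasoning
  eq′ : suc n ≡ suc s + w
  eq′ = trans eq (+-suc s w)

runsAfter-zero : ∀ w s n x → n ≡ s + w → runsAfter 0 n x s ≡ completions⁺ s w
runsAfter-zero zero    zero    zero    x eq = refl
runsAfter-zero (suc w) s       zero    x eq with () ← trans eq (+-suc s w)
-- `toℕ b <ᵇ 0` reduces to `false`, so `runAfter 0 x s` and `run 0 s` agree on nonempty words by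
-- computation.
runsAfter-zero (suc w) s       (suc n) x eq = runs≡completions (suc w) s (suc n) eq
runsAfter-zero zero    (suc s) (suc n) x eq = runs≡completions zero (suc s) (suc n) eq

-- The same walk as in `runs-descending`, but with exactly r letters taken; hence the single term
-- `choose r` of the transform.
runsAfter-descending : ∀ r w u v n → n ≡ u + v + w →
  runsAfter r n u (u + v) ≡ choose r (λ i → completions⁺ (v + i) w) u
runsAfter-descending zero    w u       v n       eq = trans (runsAfter-zero w (u + v) n u eq)
  (cong (λ z → completions⁺ z w) (+-comm u v))
runsAfter-descending (suc r) w zero    v zero    eq = refl
runsAfter-descending (suc r) w zero    v (suc n) eq = trans (runsAfter-suc r n 0 v) (below-0 (suc n) (λ b → runsAfter r n b (lower b v)))
runsAfter-descending (suc r) w (suc u) v (suc n) eq = begin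
  runsAfter (suc r) (suc n) (suc u) (suc (u + v))
    ≡⟨ trans (runsAfter-suc r n (suc u) (suc (u + v))) (below-suc φ u<n) ⟩
  below (suc n) u φ + runsAfter r n u (lower u (suc (u + v)))
    ≡⟨ cong₂ _+_ (sym (runsAfter-suc r n u (suc (u + v)))) (cong (runsAfter r n u) (lower-+ u v)) ⟩
  runsAfter (suc r) (suc n) u (suc (u + v)) + runsAfter r n u (u + v)
    ≡⟨ cong₂ _+_ (trans (cong (runsAfter (suc r) (suc n) u) (sym (+-suc u v)))
                        (runsAfter-descending (suc r) w u (suc v) (suc n) (trans eq (cong (_+ w) (sym (+-suc u v))))))
                 (runsAfter-descending r w u v n (suc-injective eq)) ⟩
  choose (suc r) (λ i → completions⁺ (suc v + i) w) u + choose r (λ i → completions⁺ (v + i) w) u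
    ≡⟨ cong₂ _+_ (choose-cong (suc r) (λ i → cong (λ z → completions⁺ z w) (sym (+-suc v i))) u) refl ⟩
  choose (suc r) (λ i → completions⁺ (v + i) w) (suc u) ∎
  where
  open ≡-Reasoning
  φ = λ b → runsAfter r n b (lower b (suc (u + v)))
  u<n : u < suc n
  u<n = subst (u <_) (sym eq) (s≤s (≤-trans (m≤m+n u v) (m≤m+n (u + v) w)))

runsFrom≡firstRun : ∀ r w s n → n ≡ s + w → runsFrom r n s ≡ firstRun r s w
runsFrom≡firstRun r zero    s zero    eq = refl
runsFrom≡firstRun r zero    s (suc n) eq = trans (runsFrom-suc r n s)
  (trans (cong (λ z → above (suc n) z (λ b → runsAfter r n b b)) (sym (trans eq (+-identityʳ s)))) (above-full (suc n) (λ b → runsAfter r n b b)))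
runsFrom≡firstRun r (suc w) s zero    eq with () ← trans eq (+-suc s w)
runsFrom≡firstRun r (suc w) s (suc n) eq = begin
  runsFrom r (suc n) s
    ≡⟨ trans (runsFrom-suc r n s) (above-suc (λ b → runsAfter r n b b) (subst (s <_) (sym eq′) (s≤s (m≤m+n s w)))) ⟩
  above (suc n) (suc s) (λ b → runsAfter r n b b) + runsAfter r n s s
    ≡⟨ cong₂ _+_ (trans (sym (runsFrom-suc r n (suc s))) (runsFrom≡firstRun r w (suc s) (suc n) eq′))
                 (trans (cong (runsAfter r n s) (sym (+-identityʳ s)))
                        (runsAfter-descending r w s 0 n
                          (trans (suc-injective eq′) (cong (_+ w) (sym (+-identityʳ s)))))) ⟩
  firstRun r s (suc w) ∎
  where
  open ≡-Reasoning
  eq′ : suc n ≡ suc s + w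
  eq′ = trans eq (+-suc s w)

-- Avoidance and prefixes

-- Here a is an earlier letter in the role of the 3.
NoRiseBelow : ∀ {m n} → Fin m → Vec (Fin m) n → Set
NoRiseBelow a []          = ⊤
NoRiseBelow a (b ∷ [])    = ⊤
NoRiseBelow a (b ∷ c ∷ w) = ¬ (b Fin.< c × c Fin.< a) × NoRiseBelow a (c ∷ w)

Avoiding : ∀ {m n} → Vec (Fin m) n → Set
Avoiding []      = ⊤
Avoiding (a ∷ w) = NoRiseBelow a w × Avoiding w

NoRiseBelow-mono : ∀ {m n} {a a′ : Fin m} (w : Vec (Fin m) n) → a Fin.≤ a′ → NoRiseBelow a′ w → NoRiseBelow a w
NoRiseBelow-mono []          a≤a′ _       = tt
NoRiseBelow-mono (b ∷ [])    a≤a′ _       = tt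
NoRiseBelow-mono (b ∷ c ∷ w) a≤a′ (h , t) =
  (λ (b<c , c<a) → h (b<c , ≤-trans c<a a≤a′)) , NoRiseBelow-mono (c ∷ w) a≤a′ t

NoRiseBelow-self : ∀ {m n} (b : Fin m) (w : Vec (Fin m) n) → NoRiseBelow b w → NoRiseBelow b (b ∷ w)
NoRiseBelow-self b []      _ = tt
NoRiseBelow-self b (c ∷ w) h = (λ (b<c , c<b) → <-asym b<c c<b) , h

NoRiseBelow-lookup : ∀ {m n} (a : Fin m) (w : Vec (Fin m) n) → NoRiseBelow a w ⇔
  (∀ j j′ → toℕ j′ ≡ suc (toℕ j) → ¬ (lookup w j Fin.< lookup w j′ × lookup w j′ Fin.< a))
NoRiseBelow-lookup a w = mk⇔ (sound w) (complete w)
  where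
  sound : ∀ {n} (w : Vec _ n) → NoRiseBelow a w →
          ∀ j j′ → toℕ j′ ≡ suc (toℕ j) → ¬ (lookup w j Fin.< lookup w j′ × lookup w j′ Fin.< a)
  sound (b ∷ [])    h       fzero    fzero           ()
  sound (b ∷ c ∷ w) h       fzero    fzero           ()
  sound (b ∷ c ∷ w) (h , t) fzero    (fsuc fzero)    eq = h
  sound (b ∷ c ∷ w) h       fzero    (fsuc (fsuc j)) ()
  sound (b ∷ c ∷ w) (h , t) (fsuc j) (fsuc j′)       eq = sound (c ∷ w) t j j′ (suc-injective eq)
  complete : ∀ {n} (w : Vec _ n) →
    (∀ j j′ → toℕ j′ ≡ suc (toℕ j) → ¬ (lookup w j Fin.< lookup w j′ × lookup w j′ Fin.< a)) → NoRiseBelow a w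
  complete []          h = tt
  complete (b ∷ [])    h = tt
  complete (b ∷ c ∷ w) h = h fzero (fsuc fzero) refl , complete (c ∷ w) (λ j j′ eq → h (fsuc j) (fsuc j′) (cong suc eq))

Avoiding-lookup : ∀ {m n} (w : Vec (Fin m) n) → Avoiding w ⇔
  (∀ i j j′ → i Fin.< j → toℕ j′ ≡ suc (toℕ j) → ¬ (lookup w j Fin.< lookup w j′ × lookup w j′ Fin.< lookup w i))
Avoiding-lookup w = mk⇔ (sound w) (complete w)
  where
  sound : ∀ {n} (w : Vec _ n) → Avoiding w →
    ∀ i j j′ → i Fin.< j → toℕ j′ ≡ suc (toℕ j) → ¬ (lookup w j Fin.< lookup w j′ × lookup w j′ Fin.< lookup w i)
  sound (a ∷ w) (h , t) fzero    (fsuc j) (fsuc j′) _         eq = to (NoRiseBelow-lookup a w) h j j′ (suc-injective eq)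
  sound (a ∷ w) (h , t) (fsuc i) (fsuc j) (fsuc j′) (s≤s i<j) eq = sound w t i j j′ i<j (suc-injective eq)
  complete : ∀ {n} (w : Vec _ n) →
    (∀ i j j′ → i Fin.< j → toℕ j′ ≡ suc (toℕ j) → ¬ (lookup w j Fin.< lookup w j′ × lookup w j′ Fin.< lookup w i)) →
    Avoiding w
  complete []      h = tt
  complete (a ∷ w) h =
    from (NoRiseBelow-lookup a w) (λ j j′ eq → h fzero (fsuc j) (fsuc j′) (s≤s z≤n) (cong suc eq)) ,
    complete w (λ i j j′ i<j eq → h (fsuc i) (fsuc j) (fsuc j′) (s≤s i<j) (cong suc eq))

orderIsomorphic-312 : ∀ {n} (a b c : Fin n) →
  OrderIsomorphic (a ∷ b ∷ c ∷ []) (3 ∷ 1 ∷ 2 ∷ []) ⇔ (b Fin.< c × c Fin.< a)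
orderIsomorphic-312 a b c = mk⇔
  (λ iso → proj₂ (iso (fsuc fzero) (fsuc (fsuc fzero))) (s≤s (s≤s z≤n)) ,
           proj₂ (iso (fsuc (fsuc fzero)) fzero) (s≤s (s≤s (s≤s z≤n))))
  iso
  where
  pos : ∀ {m n p q} → m < n → p < q → (m < n → p < q) × (p < q → m < n)
  pos m<n p<q = (λ _ → p<q) , (λ _ → m<n)
  neg : ∀ {m n p q} → n ≤ m → q ≤ p → (m < n → p < q) × (p < q → m < n)
  neg n≤m q≤p = (λ m<n → contradiction n≤m (<⇒≱ m<n)) , (λ p<q → contradiction q≤p (<⇒≱ p<q))
  iso : b Fin.< c × c Fin.< a → OrderIsomorphic (a ∷ b ∷ c ∷ []) (3 ∷ 1 ∷ 2 ∷ [])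
  iso (b<c , c<a) fzero               fzero               = neg ≤-refl ≤-refl
  iso (b<c , c<a) fzero               (fsuc fzero)        = neg (<⇒≤ (<-trans b<c c<a)) (s≤s z≤n)
  iso (b<c , c<a) fzero               (fsuc (fsuc fzero)) = neg (<⇒≤ c<a) (s≤s (s≤s z≤n))
  iso (b<c , c<a) (fsuc fzero)        fzero               = pos (<-trans b<c c<a) (s≤s (s≤s z≤n))
  iso (b<c , c<a) (fsuc fzero)        (fsuc fzero)        = neg ≤-refl ≤-refl
  iso (b<c , c<a) (fsuc fzero)        (fsuc (fsuc fzero)) = pos b<c (s≤s (s≤s z≤n))
  iso (b<c , c<a) (fsuc (fsuc fzero)) fzero               = pos c<a (s≤s (s≤s (s≤s z≤n)))
  iso (b<c , c<a) (fsuc (fsuc fzero)) (fsuc fzero)        = neg (<⇒≤ b<c) (s≤s z≤n)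
  iso (b<c , c<a) (fsuc (fsuc fzero)) (fsuc (fsuc fzero)) = neg ≤-refl ≤-refl

avoiding⇔avoids : ∀ {n} (π : Vec (Fin n) n) → Avoiding π ⇔ Avoids3-12 π
avoiding⇔avoids π = mk⇔
  (λ av (i , j , j′ , i<j , adj , iso) → to (Avoiding-lookup π) av i j j′ i<j adj (to (orderIsomorphic-312 _ _ _) iso))
  (λ av → from (Avoiding-lookup π) λ i j j′ i<j adj lt → av (i , j , j′ , i<j , adj , from (orderIsomorphic-312 _ _ _) lt))


≮ᵇ⇒≥ : ∀ m n → T (not (m <ᵇ n)) → n ≤ m
≮ᵇ⇒≥ m       zero    _  = z≤n
≮ᵇ⇒≥ (suc m) (suc n) lt = s≤s (≮ᵇ⇒≥ m n lt)

≥⇒≮ᵇ : ∀ {m n} → n ≤ m → T (not (m <ᵇ n))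
≥⇒≮ᵇ z≤n       = tt
≥⇒≮ᵇ (s≤s n≤m) = ≥⇒≮ᵇ n≤m

Distinct : ∀ {m n} → Vec (Fin m) n → Set
Distinct = AllPairs _≢_

-- Of the letters read before a, only their maximum M matters for the rest of the word.

run⇔avoiding : ∀ {m n} (a M : Fin m) (w : Vec (Fin m) n) → a Fin.≤ M → Distinct (a ∷ w) →
  T (run (toℕ a) (toℕ M) w) ⇔ (NoRiseBelow M (a ∷ w) × Avoiding (a ∷ w))
run⇔avoiding a M w a≤M dist = mk⇔ (sound a M w a≤M) (complete a M w a≤M dist)
  where
  sound : ∀ {m n} (a M : Fin m) (w : Vec (Fin m) n) → a Fin.≤ M →
          T (run (toℕ a) (toℕ M) w) → NoRiseBelow M (a ∷ w) × Avoiding (a ∷ w)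
  sound a M []      a≤M _ = tt , tt , tt
  sound a M (b ∷ w) a≤M r with to T-∨ r
  ... | inj₁ descend =
    let b<a = <ᵇ⇒< _ _ (proj₁ (to T-∧ descend))
        h , t = sound b M w (≤-trans (<⇒≤ b<a) a≤M) (proj₂ (to (T-∧ {toℕ b <ᵇ toℕ a}) descend))
    in ((λ (a<b , _) → <-asym a<b b<a) , h) , NoRiseBelow-mono (b ∷ w) a≤M h , t
  ... | inj₂ rise =
    let M≤b = ≮ᵇ⇒≥ (toℕ b) (toℕ M) (proj₁ (to T-∧ rise))
        h , t = sound b b w ≤-refl (proj₂ (to (T-∧ {not (toℕ b <ᵇ toℕ M)}) rise))
    in ((λ (_ , b<M) → <⇒≱ b<M M≤b) , NoRiseBelow-mono (b ∷ w) M≤b h) ,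
       NoRiseBelow-mono (b ∷ w) (≤-trans a≤M M≤b) h , t
  complete : ∀ {m n} (a M : Fin m) (w : Vec (Fin m) n) → a Fin.≤ M → Distinct (a ∷ w) →
             NoRiseBelow M (a ∷ w) × Avoiding (a ∷ w) → T (run (toℕ a) (toℕ M) w)
  complete a M []      a≤M dist _ = tt
  complete a M (b ∷ w) a≤M ((a≢b ∷ _) ∷ dist) ((h , t) , _ , av) with Fin.<-cmp a b
  ... | tri≈ _ a≡b _ = contradiction a≡b a≢b
  ... | tri> _ _ b<a = from T-∨ (inj₁ (from T-∧ (<⇒<ᵇ b<a , complete b M w (≤-trans (<⇒≤ b<a) a≤M) dist (t , av))))
  ... | tri< a<b _ _ = from (T-∨ {(toℕ b <ᵇ toℕ a) ∧ _}) (inj₂ (from T-∧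
    (≥⇒≮ᵇ (≮⇒≥ (λ b<M → h (a<b , b<M))) , complete b b w ≤-refl dist (NoRiseBelow-self b w (proj₁ av) , av))))

-- Thresholds 0 describe the state before the first letter: there is no run to continue, and every
-- letter may open one and become the maximum.
run₀⇔avoiding : ∀ {m n} (w : Vec (Fin m) n) → Distinct w → T (run 0 0 w) ⇔ Avoiding w
run₀⇔avoiding []      dist = mk⇔ id id
run₀⇔avoiding (b ∷ w) dist = mk⇔
  (λ r → proj₂ (to (run⇔avoiding b b w ≤-refl dist) r))
  (λ av → from (run⇔avoiding b b w ≤-refl dist) (NoRiseBelow-self b w (proj₁ av) , av))

-- In use M is the first letter of the word: the last letter exceeds a whole descent as soon as it
-- exceeds its first letter.
DescendsThenExceeds : ∀ {m n} → ℕ → Fin m → Fin m → Vec (Fin m) n → Set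
DescendsThenExceeds r       a M []      = ⊥
DescendsThenExceeds zero    a M (b ∷ w) = M Fin.< b
DescendsThenExceeds (suc r) a M (b ∷ w) = b Fin.< a × DescendsThenExceeds r b M w

-- A letter below a cannot open a run, and one above M cannot continue it. So the prefix condition
-- decides which alternative of `run` holds at each letter; `M ≢ b` makes the final comparison
-- strict.
runAfter⇔ : ∀ {m n} r (a M : Fin m) (w : Vec (Fin m) n) → a Fin.≤ M → All (M ≢_) w →
  T (runAfter r (toℕ a) (toℕ M) w) ⇔ (T (run (toℕ a) (toℕ M) w) × DescendsThenExceeds r a M w)
runAfter⇔ r       a M []      a≤M M∉w         = mk⇔ (λ ()) proj₂
runAfter⇔ zero    a M (b ∷ w) a≤M (M≢b ∷ M∉w) = mk⇔
  (λ t → from (T-∨ {(toℕ b <ᵇ toℕ a) ∧ _}) (inj₂ t) , Fin.≤∧≢⇒< (≮ᵇ⇒≥ (toℕ b) (toℕ M) (proj₁ (to T-∧ t))) M≢b)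
  λ (t , M<b) → rise t M<b
  where
  rise : T (run (toℕ a) (toℕ M) (b ∷ w)) → M Fin.< b → T (runAfter 0 (toℕ a) (toℕ M) (b ∷ w))
  rise t M<b with to T-∨ t
  ... | inj₁ d = contradiction (≤-trans a≤M (<⇒≤ M<b)) (<⇒≱ (<ᵇ⇒< _ _ (proj₁ (to T-∧ d))))
  ... | inj₂ d = d
runAfter⇔ (suc r) a M (b ∷ w) a≤M (M≢b ∷ M∉w) = mk⇔
  (λ t → let b<ᵇa , t′ = to (T-∧ {toℕ b <ᵇ toℕ a}) t
             b<a = <ᵇ⇒< _ _ b<ᵇa
             t″ , d = to (runAfter⇔ r b M w (≤-trans (<⇒≤ b<a) a≤M) M∉w) t′
         in from T-∨ (inj₁ (from T-∧ (b<ᵇa , t″))) , b<a , d)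
  λ (t , b<a , d) → descend t b<a d
  where
  descend : T (run (toℕ a) (toℕ M) (b ∷ w)) → b Fin.< a → DescendsThenExceeds r b M w →
            T (runAfter (suc r) (toℕ a) (toℕ M) (b ∷ w))
  descend t b<a d with to T-∨ t
  ... | inj₁ t′ = from T-∧ (<⇒<ᵇ b<a ,
    from (runAfter⇔ r b M w (≤-trans (<⇒≤ b<a) a≤M) M∉w) (proj₂ (to (T-∧ {toℕ b <ᵇ toℕ a}) t′) , d))
  ... | inj₂ t′ = contradiction (≮ᵇ⇒≥ (toℕ b) (toℕ M) (proj₁ (to T-∧ t′))) (<⇒≱ (≤-trans b<a a≤M))

orderIsomorphic-duplicate : ∀ {n k} (a : Fin n) (u : Vec (Fin n) k) p ps →
  OrderIsomorphic (a ∷ u) (p ∷ ps) → OrderIsomorphic (a ∷ a ∷ u) (p ∷ p ∷ ps)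
orderIsomorphic-duplicate a u p ps iso fzero           fzero           = iso fzero fzero
orderIsomorphic-duplicate a u p ps iso fzero           (fsuc fzero)    = iso fzero fzero
orderIsomorphic-duplicate a u p ps iso fzero           (fsuc (fsuc j)) = iso fzero (fsuc j)
orderIsomorphic-duplicate a u p ps iso (fsuc fzero)    fzero           = iso fzero fzero
orderIsomorphic-duplicate a u p ps iso (fsuc fzero)    (fsuc fzero)    = iso fzero fzero
orderIsomorphic-duplicate a u p ps iso (fsuc fzero)    (fsuc (fsuc j)) = iso fzero (fsuc j)
orderIsomorphic-duplicate a u p ps iso (fsuc (fsuc i)) fzero           = iso (fsuc i) fzero
orderIsomorphic-duplicate a u p ps iso (fsuc (fsuc i)) (fsuc fzero)    = iso (fsuc i) fzero
orderIsomorphic-duplicate a u p ps iso (fsuc (fsuc i)) (fsuc (fsuc j)) = iso (fsuc i) (fsuc j)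

orderIsomorphic-drop₁ : ∀ {n k} (a b : Fin n) (u : Vec (Fin n) k) p q ps →
  OrderIsomorphic (a ∷ b ∷ u) (p ∷ q ∷ ps) → OrderIsomorphic (a ∷ u) (p ∷ ps)
orderIsomorphic-drop₁ a b u p q ps iso fzero    fzero    = iso fzero fzero
orderIsomorphic-drop₁ a b u p q ps iso fzero    (fsuc j) = iso fzero (fsuc (fsuc j))
orderIsomorphic-drop₁ a b u p q ps iso (fsuc i) fzero    = iso (fsuc (fsuc i)) fzero
orderIsomorphic-drop₁ a b u p q ps iso (fsuc i) (fsuc j) = iso (fsuc (fsuc i)) (fsuc (fsuc j))

-- The first letter t is kept in front while the letters after it are dropped one by one, as the
-- last letter is compared with t. Initially t is also the current letter, which
-- `orderIsomorphic-duplicate` provides for.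
descendsThenExceeds : ∀ {n P M} r (t a : Fin n) (u : Vec (Fin n) (suc r)) → P < M →
  OrderIsomorphic (t ∷ a ∷ u) (P ∷ suc r ∷ (decreasing r ∷ʳ M)) → DescendsThenExceeds r a t u
descendsThenExceeds zero    t a (c ∷ []) P<M iso = proj₂ (iso fzero (fsuc (fsuc fzero))) P<M
descendsThenExceeds (suc r) t a (b ∷ u)  P<M iso =
  proj₂ (iso (fsuc (fsuc fzero)) (fsuc fzero)) ≤-refl ,
  descendsThenExceeds r t b u P<M (orderIsomorphic-drop₁ t a (b ∷ u) _ _ _ iso)

descendsThenExceeds-lookup : ∀ {n} M r (t a : Fin n) (u : Vec (Fin n) (suc r)) → DescendsThenExceeds r a t u →
  ∀ j → (lookup (decreasing r ∷ʳ M) j ≡ M × t Fin.< lookup u j) ⊎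
        (lookup (decreasing r ∷ʳ M) j ≤ r × lookup u j Fin.< a)
descendsThenExceeds-lookup M zero    t a (c ∷ []) t<c       fzero    = inj₁ (refl , t<c)
descendsThenExceeds-lookup M (suc r) t a (b ∷ u)  (b<a , d) fzero    = inj₂ (≤-refl , b<a)
descendsThenExceeds-lookup M (suc r) t a (b ∷ u)  (b<a , d) (fsuc j)
  with descendsThenExceeds-lookup M r t b u d j
... | inj₁ last          = inj₁ last
... | inj₂ (p≤r , u<b) = inj₂ (m≤n⇒m≤1+n p≤r , <-trans u<b b<a)

orderIsomorphic-[] : ∀ {n} (a : Fin n) p → OrderIsomorphic (a ∷ []) (p ∷ [])
orderIsomorphic-[] a p fzero fzero = (λ a<a → contradiction a<a (<-irrefl refl)) , (λ p<p → contradiction p<p (<-irrefl refl))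

-- M is a variable because the maximum of the pattern stays the same while r decreases along the
-- descent.
orderIsomorphic-decreasing : ∀ {n M} r (t a : Fin n) (u : Vec (Fin n) (suc r)) → suc r < M → a Fin.≤ t →
  DescendsThenExceeds r a t u → OrderIsomorphic (a ∷ u) (suc r ∷ (decreasing r ∷ʳ M))
orderIsomorphic-decreasing {M = M} r t a u r<M a≤t d fzero    fzero    =
  (λ lt → contradiction lt (<-irrefl refl)) , (λ lt → contradiction lt (<-irrefl refl))
orderIsomorphic-decreasing {M = M} r t a u r<M a≤t d fzero    (fsuc j) with descendsThenExceeds-lookup M r t a u d j
... | inj₁ (p≡M , t<u) = (λ _ → subst (suc r <_) (sym p≡M) r<M) , (λ _ → ≤-<-trans a≤t t<u)
... | inj₂ (p≤r , u<a) = (λ a<u → contradiction a<u (<-asym u<a)) , (λ r<p → contradiction p≤r (<⇒≱ (<-trans (n<1+n r) r<p)))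
orderIsomorphic-decreasing {M = M} r t a u r<M a≤t d (fsuc i) fzero    with descendsThenExceeds-lookup M r t a u d i
... | inj₁ (p≡M , t<u) = (λ u<a → contradiction (≤-<-trans a≤t t<u) (<-asym u<a)) ,
                         (λ p<r → contradiction (subst (_< suc r) p≡M p<r) (<-asym r<M))
... | inj₂ (p≤r , u<a) = (λ _ → s≤s p≤r) , (λ _ → u<a)
orderIsomorphic-decreasing {M = M} zero    t a (c ∷ []) r<M a≤t d (fsuc i) (fsuc j) = orderIsomorphic-[] c M i j
orderIsomorphic-decreasing {M = M} (suc r) t a (b ∷ u)  r<M a≤t (b<a , d) (fsuc i) (fsuc j) =
  orderIsomorphic-decreasing r t b u (<-trans (n<1+n _) r<M) (≤-trans (<⇒≤ b<a) a≤t) d i j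

descendsThenExceeds-prefix : ∀ {m n} r (a t : Fin m) (w : Vec (Fin m) n) → DescendsThenExceeds r a t w ⇔
  (Σ[ r<n ∈ suc r ≤ n ] DescendsThenExceeds r a t (prefix r<n w))
descendsThenExceeds-prefix r       a t []      = mk⇔ (λ ()) (λ ())
descendsThenExceeds-prefix zero    a t (b ∷ w) = mk⇔ (s≤s z≤n ,_) proj₂
descendsThenExceeds-prefix (suc r) a t (b ∷ w) = mk⇔
  (λ (b<a , d) → let r<n , d′ = to (descendsThenExceeds-prefix r b t w) d in s≤s r<n , b<a , d′)
  (λ { (s≤s r<n , b<a , d) → b<a , from (descendsThenExceeds-prefix r b t w) (r<n , d) })

beginsWith⇔ : ∀ {n} r (b : Fin (suc n)) (w : Vec (Fin (suc n)) n) →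
  DescendsThenExceeds r b b w ⇔ BeginsWith (decreasingThenMax (suc (suc r))) (b ∷ w)
beginsWith⇔ r b w = mk⇔
  (λ d → let r<n , d′ = to (descendsThenExceeds-prefix r b b w) d in
    inj₂ (s≤s r<n , orderIsomorphic-decreasing r b b (prefix r<n w) ≤-refl ≤-refl d′))
  (λ { (inj₁ (() , _))
     ; (inj₂ (s≤s r<n , iso)) → from (descendsThenExceeds-prefix r b b w)
         (r<n , descendsThenExceeds r b b (prefix r<n w) ≤-refl
                  (orderIsomorphic-duplicate b (prefix r<n w) _ _ iso)) })

runFrom⇔ : ∀ {n} r (π : Vec (Fin n) n) → Distinct π →
  (Avoids3-12 π × BeginsWith (decreasingThenMax (suc (suc r))) π) ⇔ T (runFrom r 0 π)
runFrom⇔ r []      dist = mk⇔ (λ { (_ , inj₁ (_ , ())) ; (_ , inj₂ (() , _)) }) (λ ())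
runFrom⇔ r (b ∷ w) dist@(b∉w ∷ _) = mk⇔
  (λ (av , bw) → from (runAfter⇔ r b b w ≤-refl b∉w)
    (from (run₀⇔avoiding (b ∷ w) dist) (from (avoiding⇔avoids (b ∷ w)) av) , from (beginsWith⇔ r b w) bw))
  (λ t → let t′ , d = to (runAfter⇔ r b b w ≤-refl b∉w) t in
    to (avoiding⇔avoids (b ∷ w)) (to (run₀⇔avoiding (b ∷ w) dist) t′) , to (beginsWith⇔ r b w) d)

run₀⇔ : ∀ {n} (π : Vec (Fin n) n) → Distinct π →
  (Avoids3-12 π × BeginsWith (decreasingThenMax 1) π) ⇔ T (run 0 0 π)
run₀⇔ π dist = mk⇔
  (λ (av , _) → from (run₀⇔avoiding π dist) (from (avoiding⇔avoids π) av))
  (λ t → to (avoiding⇔avoids π) (to (run₀⇔avoiding π dist) t) , begins π)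
  where
  begins : ∀ {n} (π : Vec (Fin n) n) → BeginsWith (decreasingThenMax 1) π
  begins []      = inj₁ (refl , refl)
  begins (b ∷ w) = inj₂ (s≤s z≤n , orderIsomorphic-[] b 1)

-- From the counts to the theorem

N≡sumPerms : ∀ {k} (p : Vec ℕ k) n (ρ : Vec (Fin n) n → Bool) →
  (∀ π → Distinct π → (Avoids3-12 π × BeginsWith p π) ⇔ T (ρ π)) → N p n ≡ sumPerms n (λ π → ⟦ ρ π ⟧)
N≡sumPerms p n ρ ρ⇔ = begin
  N p n
    ≡⟨ length-filter-filter good? distinct? (words n n) ⟩
  ListAction.sum (List.map (λ π → ⟦ does (distinct? π) ⟧ * ⟦ does (good? π) ⟧) (words n n))
    ≡⟨ sum-words n n (λ π → ⟦ distinct π ⟧ * ⟦ does (good? π) ⟧) ⟩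
  sumWords n n (λ π → ⟦ distinct π ⟧ * ⟦ does (good? π) ⟧)
    ≡⟨ sumWords-cong n n agree ⟩
  sumWords n n (λ π → ⟦ distinct π ⟧ * ⟦ ρ π ⟧)
    ≡⟨ sumWords-distinct n (λ π → ⟦ ρ π ⟧) ⟩
  sumPerms n (λ π → ⟦ ρ π ⟧) ∎
  where
  open ≡-Reasoning
  good? : Decidable (λ π → Avoids3-12 π × BeginsWith p π)
  good? π = avoids3-12? π ×-dec beginsWith? p π
  distinct? : Decidable (Distinct {n} {n})
  distinct? = allPairs? λ i j → ¬? (i Fin.≟ j)
  agree : ∀ π → ⟦ distinct π ⟧ * ⟦ does (good? π) ⟧ ≡ ⟦ distinct π ⟧ * ⟦ ρ π ⟧
  agree π with distinct? π
  -- For words with a repeated letter the first factor makes both sides 0.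
  ... | no  _    = refl
  ... | yes dist = cong (λ z → 1 * ⟦ z ⟧) (does-⇔ (ρ⇔ π dist) (good? π) (T? (ρ π)))

N-1 : ∀ n → N (decreasingThenMax 1) n ≡ completions 0 n
N-1 n = trans (N≡sumPerms _ n (run 0 0) run₀⇔) (runs≡completions n 0 n refl)

-- Here k = r + 2: the first run has k - 1 = r + 1 letters, and r counts those after the first
-- letter.
N-2+ : ∀ r n → N (decreasingThenMax (suc (suc r))) n ≡ firstRun r 0 n
N-2+ r n = trans (N≡sumPerms _ n (runFrom r 0) (runFrom⇔ r)) (runsFrom≡firstRun r n 0 n refl)

proposition26 : ∀ {c ℓ} (R : ExponentialℚAlgebra c ℓ) → let open PowerSeries R in
    (k : ℕ) → k ≥ 1 →
    (k ≥ 2 → E (decreasingThenMax k)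
    ≋ (1/ (k ∸ 1) ! • exp (exp X)) ⊛ ∫₀ˣ (X ^^ (k ∸ 1) ⊛ exp (⊝ exp X ⊕ X)))
    × (k ≡ 1 → E (decreasingThenMax k) ≋ exp (exp X ⊖ 𝟙))
proposition26 R (suc zero)    _ = (λ { (s≤s ()) }) , λ _ →
    ≋-trans (egf-cong N-1) (egf-homogeneous (completions 0) refl λ n → completions-suc n 0)
  where open PowerSeriesProperties R
proposition26 R (suc (suc r)) _ = (λ _ →
    ≋-trans (egf-cong (N-2+ r)) (egf-inhomogeneous (firstRun r 0) (suc r) refl (firstRun₀-suc r))) , λ ()
  where open PowerSeriesProperties R
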